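{- For every integer $r\ge 2$ there is $n_0(r)$ such that the following holds. Let $n\ge n_0(r)$ and $0 \leq d \leq \frac{n}{28r^2}$, and let $G$ be a graph with $n$ vertices and minimum degree at least $\frac{(r+1)n}{2r} + d$. Then in every $r$-colouring of the edges of $G$ there is a Hamilton cycle with at least $\frac{n}{r} + 2d$ edges of the same colour.
   Context: Graphs are finite and simple. An $r$-colouring of the edges is an arbitrary map $E(G)\to[r]$. -}

module Defs where

open import Data.Bool using (Bool; T)
open import Data.Empty using (⊥-elim)
open import Data.Fin using (Fin; toℕ; _<_; _≟_)
open import Data.Fin.Permutation using (Permutation′; _⟨$⟩ʳ_)
open import Data.Fin.Properties using (<-cmp)
open import Data.List using (List; length; filter; map; allFin)
open import Data.List.Extrema.Nat using (min)
open import Data.Nat as ℕ using (ℕ; suc; NonZero; _≤_; _*_; _^_)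
open import Data.Nat.DivMod using (_mod_)
open import Data.Nat.Properties using (m*n≢0; m^n≢0)
open import Relation.Binary.Definitions using (tri<; tri≈; tri>)
open import Relation.Binary.PropositionalEquality using (_≡_; refl)
open import Relation.Nullary using (¬_)
open import Relation.Nullary.Decidable using (T?)

record Graph (n : ℕ) : Set where
  field
    adj      : Fin n → Fin n → Bool
    adj-sym  : ∀ {u v} → T (adj u v) → T (adj v u)
    adj-irr  : ∀ {v} → ¬ T (adj v v)

  _~_ : Fin n → Fin n → Set
  u ~ v = T (adj u v)

  neighbours : Fin n → List (Fin n)
  neighbours v = filter (λ u → T? (adj v u)) (allFin n)

  degree : Fin n → ℕ
  degree v = length (neighbours v)

  -- The first argument of min only matters when there are no vertices, since
  -- every degree is smaller than n.
  minDegree : ℕ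
  minDegree = min n (map degree (allFin n))

-- An undirected edge is stored once, with its endpoints in increasing order.
-- The proof fields are irrelevant, so an edge is determined by its endpoints.
record Edge {n : ℕ} (G : Graph n) : Set where
  constructor edge
  open Graph G
  field
    {lo} {hi} : Fin n
    .lo<hi    : lo < hi
    .lo~hi    : lo ~ hi

Colouring : {n : ℕ} → Graph n → ℕ → Set
Colouring G r = Edge G → Fin r

module _ {n : ℕ} (G : Graph n) where
  open Graph G

  ⟦_⟧ : ∀ {u v} → u ~ v → Edge G
  ⟦_⟧ {u} {v} u~v with <-cmp u v
  ... | tri< u<v _ _    = edge u<v u~v
  ... | tri≈ _ refl _   = ⊥-elim (adj-irr u~v)
  ... | tri> _ _ v<u    = edge v<u (adj-sym u~v)

next : ∀ {n} → Fin n → Fin n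
next {suc m} i = suc (toℕ i) mod suc m

-- A Hamilton cycle is given by a cyclic ordering of all the vertices. As n ≥ 3,
-- distinct positions i give distinct edges of the cycle.
record HamiltonCycle {n : ℕ} (G : Graph n) : Set where
  open Graph G
  field
    n≥3   : 3 ≤ n
    order : Permutation′ n

  vertex : Fin n → Fin n
  vertex i = order ⟨$⟩ʳ i

  field
    consecutive : ∀ i → vertex i ~ vertex (next i)

  cycleEdge : Fin n → Edge G
  cycleEdge i = ⟦_⟧ G (consecutive i)

  edgesOfColour : ∀ {r} → Colouring G r → Fin r → ℕ
  edgesOfColour c k = length (filter (λ i → c (cycleEdge i) ≟ k) (allFin n))

2r≢0 : ∀ r .{{_ : NonZero r}} → NonZero (2 * r)
2r≢0 r = m*n≢0 2 r

28r²≢0 : ∀ r .{{_ : NonZero r}} → NonZero (28 * r ^ 2)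
28r²≢0 r = m*n≢0 28 (r ^ 2) {{_}} {{m^n≢0 r 2}}

{-# OPTIONS --safe #-}

-- Let δ be the minimum degree and k ≤ 2δ − n. Reversing segments of a cyclic order of the
-- vertices (Pósa) extends every linear forest with k edges to a Hamilton cycle, so a linear
-- forest with k edges in one colour i is all that is needed. Take a linear forest of colour i
-- with the most edges, f < k say, and let Sᵢ be the set of vertices with at least four
-- neighbours of colour i among the first vertices of its paths. By exchanges, the successors
-- of Sᵢ on the paths lie outside Sᵢ and are pairwise non-adjacent in colour i. Hence
-- 2|Sᵢ| ≤ f, and at most f(f − 2|Sᵢ|)/2 + O(n) edges of colour i avoid Sᵢ. As the |Sᵢ| add up
-- to about n/2 at most, many vertices avoid all Sᵢ, and by the degree condition they span
-- more edges than the colours can provide.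

module Submission where

open import Defs
open import Data.Bool using (Bool; true; false; T; not; _∧_)
open import Data.Bool.ListAction as Bool using ()
open import Data.Bool.Properties using (T?)
open import Data.Empty using (⊥; ⊥-elim)
open import Data.Fin using (Fin; zero; suc; inject₁; fromℕ; toℕ; _≟_)
open import Data.Fin.Permutation using (permutation)
open import Data.Fin.Properties using (<-cmp; <-asym; toℕ-injective; toℕ-inject₁; toℕ-fromℕ; toℕ-fromℕ<; toℕ<n)
open import Data.Fin.Relation.Unary.Top using (view; ‵fromℕ; ‵inject₁)
open import Data.Integer as ℤ using (-[1+_]; +≤+)
import Data.Integer.Properties as ℤ
open import Data.List using (List; []; _∷_; _++_; map; length; concatMap; tabulate; allFin; filter)
open import Data.List.Extrema.Nat using (min≤xs)
open import Data.List.Membership.Propositional using (_∈_)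
open import Data.List.Membership.Propositional.Properties
  using (∈-∃++; ∈-++⁻; ∈-map⁺; ∈-tabulate⁺; ∈-tabulate⁻; ∈-allFin)
open import Data.List.Properties
  using (map-++; map-cong; map-tabulate; ++-identityʳ; concatMap-++; concatMap-map; concat-map-[_]; length-++;
         length-tabulate; tabulate-cong)
open import Data.List.Relation.Binary.Permutation.Propositional
  using (_↭_; ↭-refl; ↭-sym; ↭-trans; ↭-reflexive; ↭⇒↭ₛ)
open import Data.List.Relation.Binary.Permutation.Propositional.Properties as Perm
  using (shift; ++⁺ˡ; ++⁺ʳ; ++⁺; ++-comm; ++-commutativeMonoid; ↭-length; ∈-resp-↭)
import Data.List.Relation.Binary.Permutation.Setoid.Properties as Permₛ
import Data.List.Relation.Unary.All as All
open import Data.List.Relation.Unary.All.Properties using (all⁺)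
open import Data.List.Relation.Unary.AllPairs using (_∷_)
open import Data.List.Relation.Unary.Any using (here; there)
open import Data.List.Relation.Unary.Unique.Propositional using (Unique)
open import Data.List.Relation.Unary.Unique.Propositional.Properties using (allFin⁺)
open import Data.Nat as ℕ using (ℕ; zero; suc; NonZero; _^_; z≤n; s≤s; >-nonZero)
open import Data.Nat.Coprimality using (Coprime)
open import Data.Nat.ListAction using (sum)
open import Data.Nat.ListAction.Properties using (sum-++; sum-↭)
open import Data.Nat.Properties hiding (_≟_; <-cmp; <-asym)
open import Data.Nat.Tactic.RingSolver using (solve-∀)
open import Data.Product using (∃-syntax; Σ-syntax; _×_; _,_; proj₁; proj₂)
open import Data.Rational as ℚ using (ℚ; 0ℚ; mkℚ; toℚᵘ)
import Data.Rational.Properties as ℚ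
open import Data.Rational.Unnormalised as ℚᵘ using (mkℚᵘ; *≤*)
import Data.Rational.Unnormalised.Properties as ℚᵘ
open import Data.Sum using (_⊎_; inj₁; inj₂; [_,_]′)
open import Data.Unit using (⊤; tt)
open import Function using (_∘_; id)
open import Relation.Binary.Definitions using (tri<; tri≈; tri>)
open import Relation.Binary.PropositionalEquality
open import Relation.Nullary using (¬_; yes; no; contradiction; does)
open import Relation.Nullary.Decidable using (dec-true)
open import Relation.Unary using (Decidable)
import Algebra.Solver.CommutativeMonoid as CMSolver

-- Write s for the size of one Sᵢ and t for the number of vertices outside Sᵢ that have a
-- predecessor; then t + s = f. Of the t² ordered pairs of such vertices, the s² pairs of successors
-- of Sᵢ are non-edges, which leaves t² - s² = f(f - 2s). As 2s ≤ f, this grows with f, so f may be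
-- replaced by k. The vertices without predecessor cost at most 6n, since a vertex outside Sᵢ sees
-- at most three of them. No maximum forest is chosen: exchanges are carried out until there are k
-- edges or none applies.
--
-- With m vertices outside all Sᵢ and k close to n/r, summing over the colours gives 2m² - (n + 3k)m
-- + 2kn ≤ small errors. The discriminant of the left side is (n - k)(n - 9k), so for small k there
-- are roots, and only the bound 2s ≤ f, which forces m to be about n/2 or more, leads past them. At
-- m = n/2 the value is kn/2, and this margin has to absorb the errors. Hence the bound on d: for k
-- about n/r + 2d, the excess e = rk - n is about 2rd, at most n/(14r).

module _ where

  open import Data.Nat using (_+_; _*_; _∸_; _⊓_; _≤_; _<_; _<?_; _≤ᵇ_)
  open import Data.Nat.DivMod using (_/_; _%_; m/n*n≤m; m≡m%n+[m/n]*n; m%n<n; m<n⇒m%n≡m; n%n≡0)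

  -- Finite sums over lists

  private variable
    A B : Set

  ∑ : List A → (A → ℕ) → ℕ
  ∑ xs f = sum (map f xs)

  syntax ∑ xs (λ x → e) = ∑[ x ∈ xs ] e
  infix 5 ∑

  ∑-mono : ∀ (xs : List A) {f g : A → ℕ} → (∀ {x} → x ∈ xs → f x ≤ g x) → ∑ xs f ≤ ∑ xs g
  ∑-mono []       f≤g = z≤n
  ∑-mono (x ∷ xs) f≤g = +-mono-≤ (f≤g (here refl)) (∑-mono xs (f≤g ∘ there))

  ∑-cong : ∀ (xs : List A) {f g : A → ℕ} → (∀ x → f x ≡ g x) → ∑ xs f ≡ ∑ xs g
  ∑-cong xs f≗g = cong sum (map-cong f≗g xs)

  ∑-+ : ∀ (xs : List A) (f g : A → ℕ) → ∑ xs (λ x → f x + g x) ≡ ∑ xs f + ∑ xs g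
  ∑-+ []       f g = refl
  ∑-+ (x ∷ xs) f g = trans (cong (f x + g x +_) (∑-+ xs f g)) (interchange (f x) (g x) _ _)
    where
    interchange : ∀ a b c d → a + b + (c + d) ≡ a + c + (b + d)
    interchange = solve-∀

  ∑-*ˡ : ∀ (xs : List A) c (f : A → ℕ) → ∑ xs (λ x → c * f x) ≡ c * ∑ xs f
  ∑-*ˡ []       c f = sym (*-zeroʳ c)
  ∑-*ˡ (x ∷ xs) c f = trans (cong (c * f x +_) (∑-*ˡ xs c f)) (sym (*-distribˡ-+ c (f x) _))

  ∑-*ʳ : ∀ (xs : List A) c (f : A → ℕ) → ∑ xs (λ x → f x * c) ≡ ∑ xs f * c
  ∑-*ʳ xs c f = trans (∑-cong xs λ x → *-comm (f x) c) (trans (∑-*ˡ xs c f) (*-comm c _))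

  ∑-const : ∀ (xs : List A) c → ∑ xs (λ _ → c) ≡ length xs * c
  ∑-const []       c = refl
  ∑-const (x ∷ xs) c = cong (c +_) (∑-const xs c)

  ∑-swap : ∀ (xs : List A) (ys : List B) (f : A → B → ℕ) →
           ∑[ x ∈ xs ] ∑[ y ∈ ys ] f x y ≡ ∑[ y ∈ ys ] ∑[ x ∈ xs ] f x y
  ∑-swap []       ys f = sym (trans (∑-const ys 0) (*-zeroʳ (length ys)))
  ∑-swap (x ∷ xs) ys f = trans (cong (∑ ys (f x) +_) (∑-swap xs ys f)) (sym (∑-+ ys (f x) _))

  ∑-++ : ∀ (xs ys : List A) (f : A → ℕ) → ∑ (xs ++ ys) f ≡ ∑ xs f + ∑ ys f
  ∑-++ xs ys f = trans (cong sum (map-++ f xs ys)) (sum-++ (map f xs) (map f ys))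

  ∑-↭ : ∀ {xs ys : List A} → xs ↭ ys → ∀ (f : A → ℕ) → ∑ xs f ≡ ∑ ys f
  ∑-↭ p f = sum-↭ (Perm.map⁺ f p)

  ∑-concatMap : ∀ (h : A → List B) xs (f : B → ℕ) → ∑ (concatMap h xs) f ≡ ∑[ x ∈ xs ] ∑ (h x) f
  ∑-concatMap h []       f = refl
  ∑-concatMap h (x ∷ xs) f = trans (∑-++ (h x) _ f) (cong (∑ (h x) f +_) (∑-concatMap h xs f))

  ∑-*-∑ : ∀ (xs : List A) (ys : List B) (f : A → ℕ) (g : B → ℕ) →
          ∑[ x ∈ xs ] ∑[ y ∈ ys ] f x * g y ≡ ∑ xs f * ∑ ys g
  ∑-*-∑ xs ys f g = trans (∑-cong xs λ x → ∑-*ˡ ys (f x) g) (∑-*ʳ xs (∑ ys g) f)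

  ∑-<⇒∃ : ∀ (xs : List A) (f g : A → ℕ) → ∑ xs f < ∑ xs g → ∃[ x ] x ∈ xs × f x < g x
  ∑-<⇒∃ (x ∷ xs) f g lt with f x <? g x
  ... | yes fx<gx = x , here refl , fx<gx
  ... | no fx≮gx with ∑-<⇒∃ xs f g (+-cancelˡ-< (f x) _ _ (<-≤-trans lt (+-monoˡ-≤ _ (≮⇒≥ fx≮gx))))
  ...   | y , y∈xs , fy<gy = y , there y∈xs , fy<gy

  term≤∑ : ∀ {xs : List A} {x} (f : A → ℕ) → x ∈ xs → f x ≤ ∑ xs f
  term≤∑ f (here refl)  = m≤m+n _ _
  term≤∑ {xs = y ∷ _} f (there x∈xs) = ≤-trans (term≤∑ f x∈xs) (m≤n+m _ (f y))

  ∑≡0 : ∀ (xs : List A) (f : A → ℕ) → (∀ x → x ∈ xs → f x ≡ 0) → ∑ xs f ≡ 0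
  ∑≡0 []       f f≡0 = refl
  ∑≡0 (x ∷ xs) f f≡0 rewrite f≡0 x (here refl) = ∑≡0 xs f (λ y → f≡0 y ∘ there)

  ∈-↭∷ : ∀ {xs : List A} {x} → x ∈ xs → ∃[ ys ] xs ↭ x ∷ ys
  ∈-↭∷ x∈xs with ∈-∃++ x∈xs
  ... | ys , zs , refl = ys ++ zs , shift _ ys zs

  concatMap-↭ : ∀ (h : A → List B) {xs ys} → xs ↭ ys → concatMap h xs ↭ concatMap h ys
  concatMap-↭ h _↭_.refl = ↭-refl
  concatMap-↭ h (_↭_.prep x p) = ++⁺ˡ (h x) (concatMap-↭ h p)
  concatMap-↭ h (_↭_.swap x y p) = ↭-trans (Perm.shifts (h x) (h y)) (++⁺ˡ (h y) (++⁺ˡ (h x) (concatMap-↭ h p)))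
  concatMap-↭ h (_↭_.trans p q) = ↭-trans (concatMap-↭ h p) (concatMap-↭ h q)

  -- A constructive substitute for assuming an optimal object: a failure of `P` at some entry has to
  -- be supplied in the form of `Q`, which later is an improved forest or the cycle sought.
  ∀-⊎ : ∀ (xs : List A) {Q : Set} {P : A → Set} → (∀ x → x ∈ xs → Q ⊎ P x) → Q ⊎ (∀ x → x ∈ xs → P x)
  ∀-⊎ []       h = inj₂ λ _ ()
  ∀-⊎ (x ∷ xs) h with h x (here refl) | ∀-⊎ xs (λ y → h y ∘ there)
  ... | inj₁ q | _       = inj₁ q
  ... | inj₂ _ | inj₁ q  = inj₁ q
  ... | inj₂ p | inj₂ ps = inj₂ λ { _ (here refl) → p ; y (there y∈xs) → ps y y∈xs }

  -- Indicators of Booleans and pointwise inequalities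

  χ : Bool → ℕ
  χ true  = 1
  χ false = 0

  χ≤1 : ∀ b → χ b ≤ 1
  χ≤1 true  = ≤-refl
  χ≤1 false = z≤n

  χ-T : ∀ {b} → T b → χ b ≡ 1
  χ-T {true} _ = refl

  0<χ⇒T : ∀ {b} → 0 < χ b → T b
  0<χ⇒T {true} _ = tt

  χ-¬T : ∀ {b} → ¬ T b → χ b ≡ 0
  χ-¬T {true}  ¬b = ⊥-elim (¬b tt)
  χ-¬T {false} ¬b = refl

  χ-∧ : ∀ b c → χ b + χ c ≤ 1 + χ (b ∧ c)
  χ-∧ true  c = ≤-refl
  χ-∧ false c = ≤-trans (χ≤1 c) (m≤m+n 1 0)

  T-∧⁻ : ∀ {b c} → T (b ∧ c) → T b × T c
  T-∧⁻ {true} {true} _ = tt , tt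

  χ-not : ∀ b → χ (not b) + χ b ≡ 1
  χ-not true  = refl
  χ-not false = refl

  χ-sym : {V : Set} {e : V → V → Bool} → (∀ {u v} → T (e u v) → T (e v u)) → ∀ u v → χ (e u v) ≡ χ (e v u)
  χ-sym {e = e} e-sym u v with e u v | e v u | e-sym {u} {v} | e-sym {v} {u}
  ... | true  | true  | _ | _ = refl
  ... | false | false | _ | _ = refl
  ... | true  | false | h | _ = ⊥-elim (h tt)
  ... | false | true  | _ | h = ⊥-elim (h tt)

  χ-case : ∀ {Q : Set} b → (T b → Q) → Q ⊎ χ b ≡ 0
  χ-case true  h = inj₁ (h tt)
  χ-case false h = inj₂ refl

  -- For one ordered pair of vertices, `w` and `w′` mean being outside S, `q` and `q′` being a
  -- successor of S. A pair of successors is a pair outside S that is lost as an edge; the sum over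
  -- all pairs gives the saving s².
  exclusion : ∀ w w′ e q q′ → χ q ≤ χ w → χ q′ ≤ χ w′ → (T q → T q′ → χ e ≡ 0) →
              χ w * (χ w′ * χ e) + χ q * χ q′ ≤ χ w * χ w′
  exclusion w w′ e true true q≤w q′≤w′ e≡0 rewrite e≡0 tt tt | *-zeroʳ (χ w′) | *-zeroʳ (χ w) = *-mono-≤ q≤w q′≤w′
  exclusion w w′ e true false _ _ _ rewrite +-identityʳ (χ w * (χ w′ * χ e)) =
    *-monoʳ-≤ (χ w) (≤-trans (*-monoʳ-≤ (χ w′) (χ≤1 e)) (≤-reflexive (*-identityʳ _)))
  exclusion w w′ e false q′ _ _ _ rewrite +-identityʳ (χ w * (χ w′ * χ e)) =
    *-monoʳ-≤ (χ w) (≤-trans (*-monoʳ-≤ (χ w′) (χ≤1 e)) (≤-reflexive (*-identityʳ _)))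

  -- Here t² - s² = f(f - 2s), and passing from f to k = f + j adds j(f + k - 2s), which is
  -- nonnegative as 2s ≤ f. Subtracted terms are moved across.
  square-bound : ∀ {x s t} f k c → t + s ≡ f → s ≤ t → f ≤ k → x + s * s ≤ t * t + c →
                 2 * s ≤ k × x + 2 * k * s ≤ k * k + c
  square-bound {x} {s} {t} f k c refl s≤t f≤k hx = ≤-trans 2s≤f f≤k , main
    where
    2s≤f : 2 * s ≤ t + s
    2s≤f = ≤-trans (≤-reflexive (cong (s +_) (+-identityʳ s))) (+-monoˡ-≤ s s≤t)
    j = k ∸ (t + s)
    k≡ : t + s + j ≡ k
    k≡ = m+[n∸m]≡n f≤k
    l₁ : ∀ x s t j → x + 2 * (t + s + j) * s ≡ x + s * s + (2 * t * s + s * s + j * (2 * s))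
    l₁ = solve-∀
    l₂ : ∀ s t j c → t * t + c + (2 * t * s + s * s + j * (t + s)) + j * (t + s + j) ≡ (t + s + j) * (t + s + j) + c
    l₂ = solve-∀
    main : x + 2 * k * s ≤ k * k + c
    main = subst (λ k → x + 2 * k * s ≤ k * k + c) k≡ (begin
      x + 2 * (t + s + j) * s                       ≡⟨ l₁ x s t j ⟩
      x + s * s + (2 * t * s + s * s + j * (2 * s)) ≤⟨ +-mono-≤ hx (+-monoʳ-≤ (2 * t * s + s * s) (*-monoʳ-≤ j 2s≤f)) ⟩
      t * t + c + (2 * t * s + s * s + j * (t + s)) ≤⟨ m≤m+n _ _ ⟩
      _                                             ≡⟨ l₂ s t j c ⟩
      (t + s + j) * (t + s + j) + c ∎)
      where open ≤-Reasoning

  implies-≤-not : ∀ {Q : Set} b c → (T b → T c → Q) → Q ⊎ χ b ≤ χ (not c)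
  implies-≤-not false c     h = inj₂ z≤n
  implies-≤-not true  false h = inj₂ ≤-refl
  implies-≤-not true  true  h = inj₁ (h tt tt)

  implies-≡0 : ∀ {Q : Set} b c d → (T b → T c → T d → Q) → Q ⊎ (T b → T c → χ d ≡ 0)
  implies-≡0 true  true  true  h = inj₁ (h tt tt tt)
  implies-≡0 true  true  false h = inj₂ λ _ _ → refl
  implies-≡0 true  false d     h = inj₂ λ _ ()
  implies-≡0 false c     d     h = inj₂ λ ()

  χ-small : ∀ m → χ (not (4 ≤ᵇ m)) * m ≤ 3
  χ-small 0 = z≤n
  χ-small 1 = s≤s z≤n
  χ-small 2 = s≤s (s≤s z≤n)
  χ-small 3 = ≤-refl
  χ-small (suc (suc (suc (suc m)))) = z≤n

  -- Walks, their steps and reversal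

  module _ {V : Set} (E : V → V → Set) where

    data Walk : V → V → Set where
      [_]  : ∀ v → Walk v v
      step : ∀ u {v w} → E u v → Walk v w → Walk u w

  module _ {V : Set} {E : V → V → Set} where

    verts : ∀ {a b} → Walk E a b → List V
    verts [ v ]        = v ∷ []
    verts (step u _ p) = u ∷ verts p

    steps : ∀ {a b} → Walk E a b → List (V × V)
    steps [ v ]            = []
    steps (step u {v} _ p) = (u , v) ∷ steps p

    join : ∀ {a b c d} → Walk E a b → E b c → Walk E c d → Walk E a d
    join [ v ]        e q = step v e q
    join (step u f p) e q = step u f (join p e q)

    verts-join : ∀ {a b c d} (p : Walk E a b) (e : E b c) (q : Walk E c d) →
                 verts (join p e q) ≡ verts p ++ verts q
    verts-join [ v ]        e q = refl
    verts-join (step u _ p) e q = cong (u ∷_) (verts-join p e q)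

    steps-join : ∀ {a b c d} (p : Walk E a b) (e : E b c) (q : Walk E c d) →
                 steps (join p e q) ≡ steps p ++ (b , c) ∷ steps q
    steps-join [ v ]            e q = refl
    steps-join (step u {v} _ p) e q = cong ((u , v) ∷_) (steps-join p e q)

    ∑-steps-join : ∀ {a b c d} (p : Walk E a b) (e : E b c) (q : Walk E c d) (f : V × V → ℕ) →
                   ∑ (steps (join p e q)) f ≡ ∑ (steps p) f + (f (b , c) + ∑ (steps q) f)
    ∑-steps-join p e q f = trans (cong (λ zs → ∑ zs f) (steps-join p e q)) (∑-++ (steps p) _ f)

    -- Each position of the walk but the first is the end of exactly one step. This and its mirror
    -- image turn sums over vertices into sums over successors or predecessors.
    ∑-verts-head : ∀ {a b} (p : Walk E a b) (f : V → ℕ) → ∑ (verts p) f ≡ f a + ∑ (steps p) (f ∘ proj₂)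
    ∑-verts-head [ v ]        f = refl
    ∑-verts-head (step u _ p) f = cong (f u +_) (∑-verts-head p f)

    ∑-verts-last : ∀ {a b} (p : Walk E a b) (f : V → ℕ) → ∑ (verts p) f ≡ f b + ∑ (steps p) (f ∘ proj₁)
    ∑-verts-last [ v ]                f = refl
    ∑-verts-last {b = b} (step u _ p) f = trans (cong (f u +_) (∑-verts-last p f)) (x+[y+z] (f u) (f b) _)
      where
      x+[y+z] : ∀ x y z → x + (y + z) ≡ y + (x + z)
      x+[y+z] = solve-∀

    split : ∀ {a b u v} (p : Walk E a b) → (u , v) ∈ steps p →
            Σ[ q ∈ Walk E a u ] Σ[ e ∈ E u v ] Σ[ s ∈ Walk E v b ] p ≡ join q e s
    split (step u e p) (here refl) = [ u ] , e , p , refl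
    split (step u e p) (there z∈p) with split p z∈p
    ... | q , f , s , refl = step u e q , f , s , refl

    module _ (sy : ∀ {u v} → E u v → E v u) where

      rev : ∀ {a b} → Walk E a b → Walk E b a
      rev [ v ]        = [ v ]
      rev (step u e p) = join (rev p) (sy e) [ u ]

      verts-rev : ∀ {a b} (p : Walk E a b) → verts (rev p) ↭ verts p
      verts-rev [ v ]        = ↭-refl
      verts-rev (step u e p) =
        ↭-trans (↭-reflexive (verts-join (rev p) _ [ u ])) (↭-trans (++⁺ʳ _ (verts-rev p)) (++-comm (verts p) _))

      ∑-steps-rev : ∀ {a b} (p : Walk E a b) (f : V × V → ℕ) → (∀ u v → f (u , v) ≡ f (v , u)) →
                    ∑ (steps (rev p)) f ≡ ∑ (steps p) f
      ∑-steps-rev [ v ]            f f-sym = refl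
      ∑-steps-rev (step u {v} e p) f f-sym =
        trans (∑-steps-join (rev p) _ [ u ] f)
          (trans (cong₂ _+_ (∑-steps-rev p f f-sym) (trans (+-identityʳ _) (f-sym v u)))
            (+-comm _ (f (u , v))))

  -- Linear forests

  -- Walks need not be simple. They form a spanning linear forest once `cover` is a permutation of
  -- the list of all vertices without repetition; isolated vertices are walks without steps.
  record Arc {V : Set} (E : V → V → Set) : Set where
    constructor arc
    field
      {source target} : V
      walk        : Walk E source target

  open Arc public

  module _ {V : Set} {E : V → V → Set} where

    cover : List (Arc E) → List V
    cover = concatMap (verts ∘ walk)

    edges : List (Arc E) → List (V × V)
    edges = concatMap (steps ∘ walk)

    cover-↭ : ∀ {ps qs : List (Arc E)} → ps ↭ qs → cover ps ↭ cover qs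
    cover-↭ = concatMap-↭ (verts ∘ walk)

    ∑-cover-heads : ∀ ps (f : V → ℕ) → ∑ (cover ps) f ≡ ∑ ps (f ∘ source) + ∑ (edges ps) (f ∘ proj₂)
    ∑-cover-heads ps f = begin
      ∑ (cover ps) f
        ≡⟨ ∑-concatMap _ ps f ⟩
      ∑[ p ∈ ps ] ∑ (verts (walk p)) f
        ≡⟨ ∑-cong ps (λ p → ∑-verts-head (walk p) f) ⟩
      ∑[ p ∈ ps ] (f (source p) + ∑ (steps (walk p)) (f ∘ proj₂))
        ≡⟨ ∑-+ ps _ _ ⟩
      ∑ ps (f ∘ source) + (∑[ p ∈ ps ] ∑ (steps (walk p)) (f ∘ proj₂))
        ≡⟨ cong (∑ ps (f ∘ source) +_) (∑-concatMap _ ps _) ⟨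
      ∑ ps (f ∘ source) + ∑ (edges ps) (f ∘ proj₂) ∎
      where open ≡-Reasoning

    ∑-cover-lasts : ∀ ps (f : V → ℕ) → ∑ (cover ps) f ≡ ∑ ps (f ∘ target) + ∑ (edges ps) (f ∘ proj₁)
    ∑-cover-lasts ps f = begin
      ∑ (cover ps) f
        ≡⟨ ∑-concatMap _ ps f ⟩
      ∑[ p ∈ ps ] ∑ (verts (walk p)) f
        ≡⟨ ∑-cong ps (λ p → ∑-verts-last (walk p) f) ⟩
      ∑[ p ∈ ps ] (f (target p) + ∑ (steps (walk p)) (f ∘ proj₁))
        ≡⟨ ∑-+ ps _ _ ⟩
      ∑ ps (f ∘ target) + (∑[ p ∈ ps ] ∑ (steps (walk p)) (f ∘ proj₁))
        ≡⟨ cong (∑ ps (f ∘ target) +_) (∑-concatMap _ ps _) ⟨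
      ∑ ps (f ∘ target) + ∑ (edges ps) (f ∘ proj₁) ∎
      where open ≡-Reasoning

    length-cover : ∀ ps → length (cover ps) ≡ length ps + length (edges ps)
    length-cover ps = trans (sym (∑-1 (cover ps))) (trans (∑-cover-heads ps _) (cong₂ _+_ (∑-1 ps) (∑-1 (edges ps))))
      where
      ∑-1 : ∀ {A : Set} (xs : List A) → ∑ xs (λ _ → 1) ≡ length xs
      ∑-1 xs = trans (∑-const xs 1) (*-identityʳ _)

  -- Exchanges

  module LinearForest {V : Set} (e : V → V → Bool) (e-sym : ∀ {u v} → T (e u v) → T (e v u)) (e-irr : ∀ {v} → ¬ T (e v v)) where

    E : V → V → Set
    E u v = T (e u v)

    _⇝_ : V → V → Set
    _⇝_ = Walk E

    -- Walks and edges together number as many as the covered vertices, so fewer walks means more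
    -- edges; the number of walks also serves as termination measure.
    Better : List (Arc E) → Set
    Better ps = Σ[ qs ∈ List (Arc E) ] length qs < length ps × cover qs ↭ cover ps

    Better-↭ : ∀ {ps qs} → ps ↭ qs → Better qs → Better ps
    Better-↭ p (rs , l , c) =
      rs , subst (length rs <_) (sym (↭-length p)) l , ↭-trans c (↭-sym (cover-↭ p))

    record Reordered (a b : V) (xs : List V) : Set where
      constructor _,_
      field
        walk′  : a ⇝ b
        verts↭ : verts walk′ ↭ xs

    whole : ∀ {a b} (p : a ⇝ b) → Reordered a b (verts p)
    whole p = p , ↭-refl

    back : ∀ {a b} (p : a ⇝ b) → Reordered b a (verts p)
    back p = rev e-sym p , verts-rev e-sym p

    glue : ∀ {a b c d xs ys} → Reordered a b xs → E b c → Reordered c d ys → Reordered a d (xs ++ ys)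
    glue (p , p↭) f (q , q↭) = join p f q , ↭-trans (↭-reflexive (verts-join p f q)) (++⁺ p↭ q↭)

    heads : V → List (Arc E) → ℕ
    heads v ps = ∑[ p ∈ ps ] χ (e v (source p))

    pick : ∀ v ps → 0 < heads v ps → ∃[ p ] ∃[ qs ] ps ↭ p ∷ qs × E v (source p)
    pick v ps 0<h with ∑-<⇒∃ ps (λ _ → 0) _ (subst (_< heads v ps) (sym (trans (∑-const ps 0) (*-zeroʳ (length ps)))) 0<h)
    ... | p , p∈ps , 0<χ with ∈-↭∷ p∈ps
    ...   | qs , ps↭ = p , qs , ps↭ , 0<χ⇒T 0<χ

    open CMSolver (++-commutativeMonoid {A = V}) using (solve; _⊕_; _⊜_) renaming (id to ∅)

    -- The index records the vertices of the new walks as a formal concatenation of old segments, so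
    -- that preservation of the cover becomes an identity in a commutative monoid, left to the
    -- solver.
    data Reorders : List V → Set where
      []  : Reorders []
      _∷_ : ∀ {a b xs ys} → Reordered a b xs → Reorders ys → Reorders (xs ++ ys)

    infixr 5 _∷_

    arcs : ∀ {xs} → Reorders xs → List (Arc E)
    arcs []       = []
    arcs (r ∷ rs) = arc (Reordered.walk′ r) ∷ arcs rs

    cover-arcs : ∀ {xs} (rs : Reorders xs) → cover (arcs rs) ↭ xs
    cover-arcs []       = ↭-refl
    cover-arcs (r ∷ rs) = ++⁺ (Reordered.verts↭ r) (cover-arcs rs)

    improve : ∀ {ps rs xs} (olds : List (Arc E)) (news : Reorders xs) → ps ↭ olds ++ rs →
              length (arcs news) < length olds → xs ↭ cover olds → Better ps
    improve {rs = rs} olds news ps↭ len cov = Better-↭ ps↭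
      ( arcs news ++ rs
      , subst₂ _<_ (sym (length-++ (arcs news))) (sym (length-++ olds)) (+-monoˡ-< (length rs) len)
      , ↭-trans (↭-reflexive (concatMap-++ _ (arcs news) rs))
          (↭-trans (++⁺ʳ (cover rs) (↭-trans (cover-arcs news) cov)) (↭-reflexive (sym (concatMap-++ _ olds rs)))) )

    -- An exchange needs the source of a walk other than the at most three it already involves.
    Popular : List (Arc E) → V → Set
    Popular ps v = 4 ≤ heads v ps

    -- Each walk already in use contributes at most one to `heads v ps`, so a larger count leaves a
    -- neighbouring source elsewhere.
    pick-outside : ∀ {ps} olds {qs} v → ps ↭ olds ++ qs → length olds < heads v ps →
                   ∃[ x ] ∃[ rs ] ps ↭ x ∷ olds ++ rs × E v (source x)
    pick-outside {ps} olds {qs} v ps↭ big with pick v qs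
      (+-cancelˡ-< (length olds) 0 _ (begin-strict
        length olds + 0               ≡⟨ +-identityʳ _ ⟩
        length olds                   <⟨ big ⟩
        heads v ps                    ≡⟨ ∑-↭ ps↭ _ ⟩
        heads v (olds ++ qs)          ≡⟨ ∑-++ olds qs _ ⟩
        heads v olds + heads v qs     ≤⟨ +-monoˡ-≤ (heads v qs) (∑-mono olds λ _ → χ≤1 _) ⟩
        ∑ olds (λ _ → 1) + heads v qs ≡⟨ cong (_+ heads v qs) (trans (∑-const olds 1) (*-identityʳ _)) ⟩
        length olds + heads v qs      ∎))
      where open ≤-Reasoning
    ... | x , rs , qs↭ , f = x , rs , ↭-trans ps↭ (↭-trans (++⁺ˡ olds qs↭) (shift x olds rs)) , f

    merge-head : ∀ {ps p} → p ∈ ps → Popular ps (source p) → Better ps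
    merge-head {p = arc p} p∈ps pop with ∈-↭∷ p∈ps
    ... | qs , ps↭ with pick-outside (arc p ∷ []) _ ps↭ (≤-trans (s≤s (s≤s z≤n)) pop)
    ...   | arc x , rs , ps↭′ , f = improve (arc x ∷ arc p ∷ []) (new ∷ []) ps↭′ ≤-refl
              (solve 2 (λ p x → (p ⊕ x) ⊕ ∅ ⊜ x ⊕ (p ⊕ ∅)) ↭-refl (verts p) (verts x))
      where new = glue (back p) f (whole x)

    merge-target : ∀ {ps p} → p ∈ ps → Popular ps (target p) → Better ps
    merge-target {p = arc p} p∈ps pop with ∈-↭∷ p∈ps
    ... | qs , ps↭ with pick-outside (arc p ∷ []) _ ps↭ (≤-trans (s≤s (s≤s z≤n)) pop)
    ...   | arc x , rs , ps↭′ , f = improve (arc x ∷ arc p ∷ []) (new ∷ []) ps↭′ ≤-refl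
              (solve 2 (λ p x → (p ⊕ x) ⊕ ∅ ⊜ x ⊕ (p ⊕ ∅)) ↭-refl (verts p) (verts x))
      where new = glue (whole p) f (whole x)

    ∈-edges⁻ : ∀ (ps : List (Arc E)) {z} → z ∈ edges ps → ∃[ p ] ∃[ qs ] ps ↭ p ∷ qs × z ∈ steps (walk p)
    ∈-edges⁻ (p ∷ ps) z∈ with ∈-++⁻ (steps (walk p)) z∈
    ... | inj₁ z∈p = p , ps , ↭-refl , z∈p
    ... | inj₂ z∈ps with ∈-edges⁻ ps z∈ps
    ...   | q , qs , ps↭ , z∈q = q , p ∷ qs , ↭-trans (_↭_.prep p ps↭) (_↭_.swap p q ↭-refl) , z∈q

    -- With p = a b cut between u and v, the walks a x and y⁻¹ b replace p, x and y.
    popular-step : ∀ {ps u v} → (u , v) ∈ edges ps → Popular ps u → Popular ps v → Better ps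
    popular-step {ps} {u} {v} z∈ popu popv with ∈-edges⁻ ps z∈
    ... | arc p , qs , ps↭ , z∈p with split p z∈p
    ...   | a , _ , b , refl with pick-outside (arc p ∷ []) u ps↭ (≤-trans (s≤s (s≤s z≤n)) popu)
    ...     | arc x , rs , ps↭′ , f with pick-outside (arc x ∷ arc p ∷ []) v ps↭′ (≤-trans (s≤s (s≤s (s≤s z≤n))) popv)
    ...       | arc y , ts , ps↭″ , g =
                improve (arc y ∷ arc x ∷ arc p ∷ []) (new₁ ∷ new₂ ∷ []) ps↭″ ≤-refl
                  (↭-trans
                    (solve 4 (λ a b x y → (a ⊕ x) ⊕ ((y ⊕ b) ⊕ ∅) ⊜ y ⊕ (x ⊕ ((a ⊕ b) ⊕ ∅)))
                      ↭-refl (verts a) (verts b) (verts x) (verts y))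
                    (↭-reflexive (cong (λ vs → verts y ++ verts x ++ vs ++ []) (sym (verts-join a _ b)))))
      where
      new₁ = glue (whole a) f (whole x)
      new₂ = glue (back y) (e-sym g) (whole b)

    Before : ∀ {a b} → V × V → V × V → a ⇝ b → Set
    Before {a} {b} (u , v) (u′ , v′) p =
      Σ[ q ∈ a ⇝ u ] Σ[ f ∈ E u v ] Σ[ s ∈ v ⇝ u′ ] Σ[ g ∈ E u′ v′ ] Σ[ t ∈ v′ ⇝ b ] p ≡ join q f (join s g t)

    -- An exchange within one walk reverses the segment between the two steps, so it has to be known
    -- which of them comes earlier.
    order : ∀ {a b z z′} (p : a ⇝ b) → z ∈ steps p → z′ ∈ steps p → z ≡ z′ ⊎ Before z z′ p ⊎ Before z′ z p
    order (step u e p) (here refl) (here refl) = inj₁ refl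
    order (step u e p) (here refl) (there z′∈) with split p z′∈
    ... | s , g , t , refl = inj₂ (inj₁ ([ u ] , e , s , g , t , refl))
    order (step u e p) (there z∈) (here refl) with split p z∈
    ... | s , g , t , refl = inj₂ (inj₂ ([ u ] , e , s , g , t , refl))
    order (step u e p) (there z∈) (there z′∈) with order p z∈ z′∈
    ... | inj₁ z≡z′ = inj₁ z≡z′
    ... | inj₂ (inj₁ (q , f , s , g , t , refl)) = inj₂ (inj₁ (step u e q , f , s , g , t , refl))
    ... | inj₂ (inj₂ (q , f , s , g , t , refl)) = inj₂ (inj₂ (step u e q , f , s , g , t , refl))

    -- With p = a b d cut at the two steps, the walks a x and y⁻¹ b⁻¹ d replace p, x and y.
    exchange-same : ∀ {ps qs a b u v u′ v′} {p : a ⇝ b} → ps ↭ arc p ∷ qs → Before (u , v) (u′ , v′) p →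
                    Popular ps u → Popular ps u′ → E v v′ → Better ps
    exchange-same {u = u} {u′ = u′} {p = p} ps↭ (a , _ , b , _ , d , refl) pop pop′ vv′
      with pick-outside (arc p ∷ []) u ps↭ (≤-trans (s≤s (s≤s z≤n)) pop)
    ... | arc x , rs , ps↭′ , f with pick-outside (arc x ∷ arc p ∷ []) u′ ps↭′ (≤-trans (s≤s (s≤s (s≤s z≤n))) pop′)
    ...   | arc y , ts , ps↭″ , g =
            improve (arc y ∷ arc x ∷ arc p ∷ []) (new₁ ∷ new₂ ∷ []) ps↭″ ≤-refl
              (↭-trans
                (solve 5 (λ a b d x y → (a ⊕ x) ⊕ (((y ⊕ b) ⊕ d) ⊕ ∅) ⊜ y ⊕ (x ⊕ ((a ⊕ (b ⊕ d)) ⊕ ∅)))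
                  ↭-refl (verts a) (verts b) (verts d) (verts x) (verts y))
                (↭-reflexive (cong (λ vs → verts y ++ verts x ++ vs ++ [])
                  (sym (trans (verts-join a _ _) (cong (verts a ++_) (verts-join b _ d)))))))
      where
      new₁ = glue (whole a) f (whole x)
      new₂ = glue (glue (back y) (e-sym g) (back b)) vv′ (whole d)

    -- With p = a b and q = c d, the walks a x, c y and b⁻¹ d replace p, q, x and y.
    exchange-distinct : ∀ {ps qs a b c d u v u′ v′} {p : a ⇝ b} {q : c ⇝ d} → ps ↭ arc q ∷ arc p ∷ qs →
                        (u , v) ∈ steps p → (u′ , v′) ∈ steps q →
                        Popular ps u → Popular ps u′ → E v v′ → Better ps
    exchange-distinct {u = u} {u′ = u′} {p = p} {q} ps↭ z∈p z′∈q pop pop′ vv′ with split p z∈p | split q z′∈q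
    ... | a , _ , b , refl | c , _ , d , refl
      with pick-outside (arc q ∷ arc p ∷ []) u ps↭ (≤-trans (s≤s (s≤s (s≤s z≤n))) pop)
    ... | arc x , rs , ps↭′ , f with pick-outside (arc x ∷ arc q ∷ arc p ∷ []) u′ ps↭′ pop′
    ...   | arc y , ts , ps↭″ , g =
            improve (arc y ∷ arc x ∷ arc q ∷ arc p ∷ []) (new₁ ∷ new₂ ∷ new₃ ∷ []) ps↭″ ≤-refl
              (↭-trans
                (solve 6 (λ a b c d x y → (a ⊕ x) ⊕ ((c ⊕ y) ⊕ ((b ⊕ d) ⊕ ∅)) ⊜ y ⊕ (x ⊕ ((c ⊕ d) ⊕ ((a ⊕ b) ⊕ ∅))))
                  ↭-refl (verts a) (verts b) (verts c) (verts d) (verts x) (verts y))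
                (↭-reflexive (cong₂ (λ vs ws → verts y ++ verts x ++ ws ++ vs ++ [])
                  (sym (verts-join a _ b)) (sym (verts-join c _ d)))))
      where
      new₁ = glue (whole a) f (whole x)
      new₂ = glue (whole c) g (whole y)
      new₃ = glue (back b) vv′ (whole d)

    -- Coinciding steps would make `v v′` a loop. For two steps of one walk the roles are swapped,
    -- if necessary, so that the earlier step is cut first; for steps of different walks there is
    -- nothing to order.
    successor-edge : ∀ {ps u v u′ v′} → (u , v) ∈ edges ps → (u′ , v′) ∈ edges ps →
                     Popular ps u → Popular ps u′ → E v v′ → Better ps
    successor-edge {ps} z∈ z′∈ pop pop′ vv′ with ∈-edges⁻ ps z∈
    ... | p , qs , ps↭ , z∈p with ∈-++⁻ (steps (walk p)) (∈-resp-↭ (concatMap-↭ (λ (q : Arc E) → steps (walk q)) ps↭) z′∈)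
    ...   | inj₁ z′∈p with order (walk p) z∈p z′∈p
    ...     | inj₁ refl = contradiction vv′ e-irr
    ...     | inj₂ (inj₁ z<z′) = exchange-same ps↭ z<z′ pop pop′ vv′
    ...     | inj₂ (inj₂ z′<z) = exchange-same ps↭ z′<z pop′ pop (e-sym vv′)
    successor-edge {ps} z∈ z′∈ pop pop′ vv′ | p , qs , ps↭ , z∈p | inj₂ z′∈qs with ∈-edges⁻ qs z′∈qs
    ...     | q , rs , qs↭ , z′∈q =
                exchange-distinct (↭-trans ps↭ (↭-trans (_↭_.prep p qs↭) (_↭_.swap p q ↭-refl))) z∈p z′∈q pop pop′ vv′

    -- The edges outside S when no exchange applies

    Sparse : List V → ℕ → Set
    Sparse all k = Σ[ S ∈ (V → Bool) ]
      2 * ∑ all (χ ∘ S) ≤ k ×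
      (∑[ u ∈ all ] ∑[ v ∈ all ] χ (not (S u)) * (χ (not (S v)) * χ (e u v))) + 2 * k * ∑ all (χ ∘ S)
        ≤ k * k + 6 * length all

    -- S consists of the popular vertices. Each of the four structural facts assumed below is tested
    -- at all walks, steps or pairs of steps, and a violation is exactly the input of an exchange.
    -- Ordered pairs are counted, so each edge outside S appears twice.
    better-or-sparse : ∀ {all} ps → cover ps ↭ all → ∀ {k} → length (edges ps) ≤ k → Better ps ⊎ Sparse all k
    better-or-sparse {all} ps ps↭ {k} f≤k = result
      where
      S : V → Bool
      S v = 4 ≤ᵇ heads v ps
      w : V → ℕ
      w v = χ (not (S v))
      Z = edges ps
      n = length all
      q : V × V → ℕ
      q z = χ (S (proj₁ z))

      popular : ∀ {v} → T (S v) → Popular ps v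
      popular {v} = ≤ᵇ⇒≤ 4 (heads v ps)

      at-most-3 : ∀ v → w v * heads v ps ≤ 3
      at-most-3 v = χ-small (heads v ps)

      module _ (source∉S : ∀ p → p ∈ ps → χ (S (source p)) ≡ 0)
               (target∉S   : ∀ p → p ∈ ps → χ (S (target p)) ≡ 0)
               (q≤w        : ∀ z → z ∈ Z → q z ≤ w (proj₂ z))
               (excl       : ∀ z → z ∈ Z → ∀ z′ → z′ ∈ Z → T (S (proj₁ z)) → T (S (proj₁ z′)) → χ (e (proj₂ z) (proj₂ z′)) ≡ 0) where

        s = ∑ all (χ ∘ S)
        t = ∑ Z (w ∘ proj₂)
        F : V → V → ℕ
        F u v = w u * (w v * χ (e u v))

        -- No target is in S, so every vertex of S has a successor.
        s≡∑q : s ≡ ∑ Z q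
        s≡∑q = trans (sym (∑-↭ ps↭ _)) (trans (∑-cover-lasts ps (χ ∘ S)) (cong (_+ ∑ Z q) (∑≡0 ps _ target∉S)))

        -- No source is in S, so all of S occurs among the ends of steps; therefore `t + s` is the
        -- number of edges.
        s≡∑₂ : s ≡ ∑ Z (χ ∘ S ∘ proj₂)
        s≡∑₂ = trans (sym (∑-↭ ps↭ _)) (trans (∑-cover-heads ps (χ ∘ S)) (cong (_+ ∑ Z (χ ∘ S ∘ proj₂)) (∑≡0 ps _ source∉S)))

        t+s : t + s ≡ length Z
        t+s = begin
          t + s                                        ≡⟨ cong (t +_) s≡∑₂ ⟩
          t + ∑ Z (χ ∘ S ∘ proj₂)                      ≡⟨ ∑-+ Z _ _ ⟨
          ∑[ z ∈ Z ] (w (proj₂ z) + χ (S (proj₂ z)))   ≡⟨ ∑-cong Z (λ z → χ-not (S (proj₂ z))) ⟩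
          ∑ Z (λ _ → 1)                                ≡⟨ ∑-const Z 1 ⟩
          length Z * 1                                 ≡⟨ *-identityʳ _ ⟩
          length Z ∎
          where open ≡-Reasoning

        s≤t : s ≤ t
        s≤t = ≤-trans (≤-reflexive s≡∑q) (∑-mono Z (q≤w _))

        inner : (∑[ z ∈ Z ] ∑[ z′ ∈ Z ] F (proj₂ z) (proj₂ z′)) + s * s ≤ t * t
        inner = begin
          (∑[ z ∈ Z ] ∑[ z′ ∈ Z ] F (proj₂ z) (proj₂ z′)) + s * s
            ≡⟨ cong ((∑[ z ∈ Z ] ∑[ z′ ∈ Z ] F (proj₂ z) (proj₂ z′)) +_) (trans (cong₂ _*_ s≡∑q s≡∑q) (sym (∑-*-∑ Z Z q q))) ⟩
          (∑[ z ∈ Z ] ∑[ z′ ∈ Z ] F (proj₂ z) (proj₂ z′)) + (∑[ z ∈ Z ] ∑[ z′ ∈ Z ] q z * q z′)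
            ≡⟨ ∑-+ Z _ _ ⟨
          (∑[ z ∈ Z ] ((∑[ z′ ∈ Z ] F (proj₂ z) (proj₂ z′)) + (∑[ z′ ∈ Z ] q z * q z′)))
            ≡⟨ ∑-cong Z (λ z → sym (∑-+ Z _ _)) ⟩
          (∑[ z ∈ Z ] ∑[ z′ ∈ Z ] (F (proj₂ z) (proj₂ z′) + q z * q z′))
            ≤⟨ ∑-mono Z (λ {z} z∈ → ∑-mono Z (λ {z′} z′∈ →
                 exclusion (not (S (proj₂ z))) (not (S (proj₂ z′))) (e (proj₂ z) (proj₂ z′)) (S (proj₁ z)) (S (proj₁ z′))
                   (q≤w z z∈) (q≤w z′ z′∈) (excl z z∈ z′ z′∈))) ⟩
          (∑[ z ∈ Z ] ∑[ z′ ∈ Z ] w (proj₂ z) * w (proj₂ z′))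
            ≡⟨ ∑-*-∑ Z Z _ _ ⟩
          t * t ∎
          where open ≤-Reasoning

        heads≤3 : ∀ u → ∑[ p ∈ ps ] F u (source p) ≤ 3
        heads≤3 u = begin
          (∑[ p ∈ ps ] F u (source p))             ≤⟨ ∑-mono ps (λ {p} _ → *-monoʳ-≤ (w u)
                                                       (≤-trans (*-monoˡ-≤ _ (χ≤1 (not (S (source p))))) (≤-reflexive (*-identityˡ _)))) ⟩
          (∑[ p ∈ ps ] w u * χ (e u (source p)))   ≡⟨ ∑-*ˡ ps (w u) _ ⟩
          w u * heads u ps                        ≤⟨ at-most-3 u ⟩
          3 ∎
          where open ≤-Reasoning

        F-sym : ∀ u v → F u v ≡ F v u
        F-sym u v = trans (cong (λ x → w u * (w v * x)) (χ-sym e-sym u v)) (x*[y*z] (w u) (w v) _)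
          where
          x*[y*z] : ∀ x y z → x * (y * z) ≡ y * (x * z)
          x*[y*z] = solve-∀

        ∑-all : ∀ (f : V → ℕ) → ∑ all f ≡ ∑ ps (f ∘ source) + ∑ Z (f ∘ proj₂)
        ∑-all f = trans (sym (∑-↭ ps↭ f)) (∑-cover-heads ps f)

        length-Z≤n : length Z ≤ n
        length-Z≤n = ≤-trans (m≤n+m _ (length ps)) (≤-reflexive (trans (sym (length-cover ps)) (↭-length ps↭)))

        -- The vertices are the sources and the ends of steps. A vertex outside S has at most three
        -- neighbours among the sources, so discarding the sources costs 3n in each of the two
        -- coordinates, whence 6n.
        outer : (∑[ u ∈ all ] ∑[ v ∈ all ] F u v) ≤ (∑[ z ∈ Z ] ∑[ z′ ∈ Z ] F (proj₂ z) (proj₂ z′)) + 6 * n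
        outer = begin
          (∑[ u ∈ all ] ∑[ v ∈ all ] F u v)
            ≡⟨ ∑-cong all (λ u → ∑-all (F u)) ⟩
          (∑[ u ∈ all ] ((∑[ p ∈ ps ] F u (source p)) + (∑[ z ∈ Z ] F u (proj₂ z))))
            ≤⟨ ∑-mono all (λ {u} _ → +-monoˡ-≤ (∑[ z ∈ Z ] F u (proj₂ z)) (heads≤3 u)) ⟩
          (∑[ u ∈ all ] (3 + (∑[ z ∈ Z ] F u (proj₂ z))))
            ≡⟨ trans (∑-+ all _ _) (cong₂ _+_ (∑-const all 3) (∑-swap all Z _)) ⟩
          n * 3 + (∑[ z ∈ Z ] ∑[ u ∈ all ] F u (proj₂ z))
            ≡⟨ cong (n * 3 +_) (∑-cong Z λ z → trans (∑-cong all λ u → F-sym u (proj₂ z)) (∑-all (F (proj₂ z)))) ⟩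
          n * 3 + (∑[ z ∈ Z ] ((∑[ p ∈ ps ] F (proj₂ z) (source p)) + (∑[ z′ ∈ Z ] F (proj₂ z) (proj₂ z′))))
            ≤⟨ +-monoʳ-≤ (n * 3) (∑-mono Z λ {z} _ → +-monoˡ-≤ (∑[ z′ ∈ Z ] F (proj₂ z) (proj₂ z′)) (heads≤3 (proj₂ z))) ⟩
          n * 3 + (∑[ z ∈ Z ] (3 + (∑[ z′ ∈ Z ] F (proj₂ z) (proj₂ z′))))
            ≡⟨ cong (n * 3 +_) (trans (∑-+ Z _ _) (cong (_+ XZ) (∑-const Z 3))) ⟩
          n * 3 + (length Z * 3 + XZ)
            ≤⟨ +-monoʳ-≤ (n * 3) (+-monoˡ-≤ XZ (*-monoˡ-≤ 3 length-Z≤n)) ⟩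
          n * 3 + (n * 3 + XZ)
            ≡⟨ lem n XZ ⟩
          XZ + 6 * n ∎
          where
          open ≤-Reasoning
          XZ = ∑[ z ∈ Z ] ∑[ z′ ∈ Z ] F (proj₂ z) (proj₂ z′)
          lem : ∀ n x → n * 3 + (n * 3 + x) ≡ x + 6 * n
          lem = solve-∀

        sparse : Sparse all k
        sparse = S , square-bound (length Z) k (6 * n) t+s s≤t f≤k (begin
          (∑[ u ∈ all ] ∑[ v ∈ all ] F u v) + s * s ≤⟨ +-monoˡ-≤ (s * s) outer ⟩
          XZ + 6 * n + s * s                         ≡⟨ lem XZ (6 * n) (s * s) ⟩
          XZ + s * s + 6 * n                         ≤⟨ +-monoˡ-≤ (6 * n) inner ⟩
          t * t + 6 * n ∎)
          where
          open ≤-Reasoning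
          XZ = ∑[ z ∈ Z ] ∑[ z′ ∈ Z ] F (proj₂ z) (proj₂ z′)
          lem : ∀ a b c → a + b + c ≡ a + c + b
          lem = solve-∀

      result : Better ps ⊎ Sparse all k
      result =
        [ inj₁ , (λ h₁ →
        [ inj₁ , (λ h₂ →
        [ inj₁ , (λ h₃ →
        [ inj₁ , (λ h₄ → inj₂ (sparse h₁ h₂ h₃ h₄)) ]′
          (∀-⊎ Z λ z z∈ → ∀-⊎ Z λ z′ z′∈ → implies-≡0 (S (proj₁ z)) (S (proj₁ z′)) (e (proj₂ z) (proj₂ z′)) λ pop pop′ →
            successor-edge {ps = ps} z∈ z′∈ (popular pop) (popular pop′)) ) ]′
          (∀-⊎ Z λ z z∈ → implies-≤-not (S (proj₁ z)) (S (proj₂ z)) λ pop pop′ →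
            popular-step {ps = ps} z∈ (popular pop) (popular pop′)) ) ]′
          (∀-⊎ ps λ p p∈ → χ-case (S (target p)) (merge-target p∈ ∘ popular)) ) ]′
          (∀-⊎ ps λ p p∈ → χ-case (S (source p)) (merge-head p∈ ∘ popular))

    Forest : List V → ℕ → Set
    Forest all k = Σ[ ps ∈ List (Arc E) ] cover ps ↭ all × k ≤ length (edges ps)

    -- `fuel` bounds the number of walks, which every exchange lowers.
    improve* : ∀ {all} k fuel ps → length ps ≤ fuel → cover ps ↭ all → Forest all k ⊎ Sparse all k
    improve* {all} k fuel ps len ps↭ = decide (≤-total k (length (edges ps)))
      where
      recurse : ∀ fuel → length ps ≤ fuel → Better ps → Forest all k ⊎ Sparse all k
      recurse zero       len (qs , shorter , qs↭) = contradiction (≤-trans shorter len) λ ()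
      recurse (suc fuel) len (qs , shorter , qs↭) = improve* k fuel qs (≤-pred (≤-trans shorter len)) (↭-trans qs↭ ps↭)

      decide : k ≤ length (edges ps) ⊎ length (edges ps) ≤ k → Forest all k ⊎ Sparse all k
      decide (inj₁ k≤) = inj₁ (ps , ps↭ , k≤)
      decide (inj₂ ≤k) = [ recurse fuel len , inj₂ ]′ (better-or-sparse ps ps↭ ≤k)

    forest-or-sparse : ∀ all k → Forest all k ⊎ Sparse all k
    forest-or-sparse all k = improve* k _ (map (λ v → arc [ v ]) all) ≤-refl
      (↭-reflexive (trans (concatMap-map _ _ all) (concat-map-[ all ])))

  -- Pósa's theorem

  -- A cyclic order of vertices cut open at one place: the relation is total, so steps may join
  -- non-adjacent vertices until all gaps are repaired.
  Tour : {V : Set} → V → V → Set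
  Tour = Walk (λ _ _ → ⊤)

  module _ {V : Set} where

    forget : ∀ {E : V → V → Set} {a b} → Walk E a b → Tour a b
    forget [ v ]        = [ v ]
    forget (step u _ p) = step u tt (forget p)

    verts-forget : ∀ {E : V → V → Set} {a b} (p : Walk E a b) → verts (forget p) ≡ verts p
    verts-forget [ v ]        = refl
    verts-forget (step u _ p) = cong (u ∷_) (verts-forget p)

    steps-forget : ∀ {E : V → V → Set} {a b} (p : Walk E a b) → steps (forget p) ≡ steps p
    steps-forget [ v ]            = refl
    steps-forget (step u {v} _ p) = cong ((u , v) ∷_) (steps-forget p)

    -- Successive walks are linked regardless of adjacency. The links can only add to the sum, so no
    -- coloured edge of the forest is lost.
    concatenate : ∀ {E : V → V → Set} p (ps : List (Arc E)) (f : V × V → ℕ) →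
                  Σ[ b ∈ V ] Σ[ q ∈ Tour (source p) b ] verts q ≡ cover (p ∷ ps) × ∑ (edges (p ∷ ps)) f ≤ ∑ (steps q) f
    concatenate p [] f = target p , forget (walk p)
      , trans (verts-forget (walk p)) (sym (++-identityʳ _))
      , ≤-reflexive (cong (λ zs → ∑ zs f) (trans (++-identityʳ _) (sym (steps-forget (walk p)))))
    concatenate p (p′ ∷ ps) f with concatenate p′ ps f
    ... | b , q , q≡ , le = b , join (forget (walk p)) tt q
      , trans (verts-join (forget (walk p)) tt q) (cong₂ _++_ (verts-forget (walk p)) q≡)
      , (begin
          ∑ (steps (walk p) ++ edges (p′ ∷ ps)) f
            ≡⟨ ∑-++ (steps (walk p)) _ f ⟩
          ∑ (steps (walk p)) f + ∑ (edges (p′ ∷ ps)) f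
            ≤⟨ +-mono-≤ (≤-reflexive (cong (λ zs → ∑ zs f) (sym (steps-forget (walk p))))) (≤-trans le (m≤n+m _ _)) ⟩
          ∑ (steps (forget (walk p))) f + (f (target p , source p′) + ∑ (steps q) f)
            ≡⟨ ∑-steps-join (forget (walk p)) tt q f ⟨
          ∑ (steps (join (forget (walk p)) tt q)) f ∎)
      where open ≤-Reasoning

    cyclic : ∀ {a b} → Tour {V} a b → (V × V → ℕ) → ℕ
    cyclic {a} {b} p f = ∑ (steps p) f + f (b , a)

    length-verts : ∀ {a b} (p : Tour {V} a b) → length (verts p) ≡ suc (length (steps p))
    length-verts [ v ]        = refl
    length-verts (step u _ p) = cong suc (length-verts p)

    -- Moves a gap at any step to the closing pair, the only position that the repair has to treat.
    rotate : ∀ {a b u v} (p : Tour {V} a b) → (u , v) ∈ steps p →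
             Σ[ q ∈ Tour v u ] verts q ↭ verts p × (∀ f → cyclic q f ≡ cyclic p f)
    rotate {a} {b} {u} {v} p z∈p with split p z∈p
    ... | x , _ , y , refl = join y tt x
      , ↭-trans (↭-reflexive (verts-join y tt x)) (↭-trans (++-comm (verts y) (verts x)) (↭-reflexive (sym (verts-join x tt y))))
      , λ f → trans (cong (_+ f (u , v)) (∑-steps-join y tt x f))
                (trans (lem (∑ (steps y) f) (f (b , a)) (∑ (steps x) f) (f (u , v)))
                  (cong (_+ f (b , a)) (sym (∑-steps-join x tt y f))))
      where
      lem : ∀ y c x d → y + (c + x) + d ≡ x + (d + y) + c
      lem = solve-∀

    -- The cyclic order b ... u v ... a becomes u ... b v ... a: the pairs uv and ab give way to bv
    -- and au. The segment turned round keeps its sum because `f` is symmetric.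
    reverse-prefix : ∀ {a b u v} (p : Tour {V} b a) → (u , v) ∈ steps p →
                     Σ[ q ∈ Tour u a ] verts q ↭ verts p ×
                       (∀ f → (∀ u v → f (u , v) ≡ f (v , u)) →
                         cyclic q f + (f (u , v) + f (a , b)) ≡ cyclic p f + (f (b , v) + f (a , u)))
    reverse-prefix {a} {b} {u} {v} p z∈p with split p z∈p
    ... | x , _ , y , refl = join (rev _ x) tt y
      , ↭-trans (↭-reflexive (verts-join (rev _ x) tt y))
          (↭-trans (++⁺ʳ (verts y) (verts-rev _ x)) (↭-reflexive (sym (verts-join x tt y))))
      , λ f f-sym → trans (cong (λ s → s + f (a , u) + (f (u , v) + f (a , b)))
                             (trans (∑-steps-join (rev _ x) tt y f) (cong (_+ (f (b , v) + ∑ (steps y) f)) (∑-steps-rev _ x f f-sym))))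
                      (trans (lem (∑ (steps x) f) (∑ (steps y) f) (f (u , v)) (f (a , b)) (f (b , v)) (f (a , u)))
                        (cong (λ s → s + f (a , b) + (f (b , v) + f (a , u))) (sym (∑-steps-join x tt y f))))
      where
      lem : ∀ x y uv ab bv au → x + (bv + y) + au + (uv + ab) ≡ x + (uv + y) + ab + (bv + au)
      lem = solve-∀

  module Posa {V : Set} (adj : V → V → Bool) (adj-sym : ∀ {u v} → T (adj u v) → T (adj v u)) (adj-irr : ∀ {v} → ¬ T (adj v v))
              (col : V → V → Bool) (col-sym : ∀ {u v} → T (col u v) → T (col v u)) (col⊆adj : ∀ {u v} → T (col u v) → T (adj u v))
              (all : List V) (k : ℕ) (degree-bound : ∀ v → length all + k ≤ 2 * (∑[ u ∈ all ] χ (adj v u))) where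

    a₂ c₂ : V × V → ℕ
    a₂ (u , v) = χ (adj u v)
    c₂ (u , v) = χ (col u v)

    close-gap : ∀ {a b} (p : Tour b a) → verts p ↭ all → k ≤ cyclic p c₂ → ¬ T (adj a b) →
                Σ[ u ∈ V ] Σ[ q ∈ Tour u a ] verts q ↭ all × k ≤ cyclic q c₂ × cyclic p a₂ < cyclic q a₂
    close-gap {a} {b} p p↭ k≤ gap = result
      where
      good : V × V → ℕ
      good (u , v) = χ (adj a u ∧ adj b v)
      Z = steps p

      deg-a : ∑[ u ∈ all ] χ (adj a u) ≡ ∑[ z ∈ Z ] χ (adj a (proj₁ z))
      deg-a = trans (sym (∑-↭ p↭ _)) (trans (∑-verts-last p _) (cong (_+ (∑[ z ∈ Z ] χ (adj a (proj₁ z)))) (χ-¬T adj-irr)))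

      deg-b : ∑[ u ∈ all ] χ (adj b u) ≡ ∑[ z ∈ Z ] χ (adj b (proj₂ z))
      deg-b = trans (sym (∑-↭ p↭ _)) (trans (∑-verts-head p _) (cong (_+ (∑[ z ∈ Z ] χ (adj b (proj₂ z)))) (χ-¬T adj-irr)))

      n≡ : length all ≡ suc (length Z)
      n≡ = trans (sym (↭-length p↭)) (length-verts p)

      average : ∀ x y {m} → m ≤ 2 * x → m ≤ 2 * y → m ≤ x + y
      average x y {m} hx hy = *-cancelˡ-≤ 2 (≤-trans (≤-reflexive (cong (m +_) (+-identityʳ m)))
        (≤-trans (+-mono-≤ hx hy) (≤-reflexive (sym (*-distribˡ-+ 2 x y)))))

      -- The degrees of `a` and `b` add up to at least n + k, whereas there are only n - 1 steps; so
      -- at least k + 1 steps are counted twice, one more than the coloured steps that must survive.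
      many-good : k < ∑ Z good
      many-good = +-cancelˡ-< (length Z) k _ (begin
        suc (length Z + k)                                                     ≡⟨ cong (_+ k) (sym n≡) ⟩
        length all + k                                                         ≤⟨ average (∑[ u ∈ all ] χ (adj a u)) (∑[ u ∈ all ] χ (adj b u)) (degree-bound a) (degree-bound b) ⟩
        (∑[ u ∈ all ] χ (adj a u)) + (∑[ u ∈ all ] χ (adj b u))                ≡⟨ cong₂ _+_ deg-a deg-b ⟩
        (∑[ z ∈ Z ] χ (adj a (proj₁ z))) + (∑[ z ∈ Z ] χ (adj b (proj₂ z)))    ≡⟨ ∑-+ Z _ _ ⟨
        (∑[ z ∈ Z ] (χ (adj a (proj₁ z)) + χ (adj b (proj₂ z))))               ≤⟨ ∑-mono Z (λ {z} _ → χ-∧ (adj a (proj₁ z)) (adj b (proj₂ z))) ⟩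
        (∑[ z ∈ Z ] (1 + good z))                                              ≡⟨ trans (∑-+ Z _ _) (cong (_+ ∑ Z good) (trans (∑-const Z 1) (*-identityʳ _))) ⟩
        length Z + ∑ Z good ∎)
        where open ≤-Reasoning

      -- If k steps are coloured exactly, then the step removed must be uncoloured.
      pivot : ∃[ z ] z ∈ Z × 0 < good z × k + c₂ z ≤ cyclic p c₂
      pivot with k <? ∑ Z c₂
      ... | no k≮ with ∑-<⇒∃ Z c₂ good (≤-<-trans (≮⇒≥ k≮) many-good)
      ...   | (u , v) , z∈ , c<good = _ , z∈ , ≤-<-trans z≤n c<good ,
                ≤-trans (≤-reflexive (trans (cong (k +_) (n≤0⇒n≡0 (≤-pred (≤-trans c<good (χ≤1 _))))) (+-identityʳ k))) k≤
      pivot | yes k< with ∑-<⇒∃ Z (λ _ → 0) good (≤-<-trans (≤-reflexive (trans (∑-const Z 0) (*-zeroʳ (length Z)))) (≤-<-trans z≤n many-good))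
      ...   | (u , v) , z∈ , 0<good = _ , z∈ , 0<good ,
                ≤-trans (+-monoʳ-≤ k (χ≤1 _)) (≤-trans (≤-reflexive (+-comm k 1)) (≤-trans k< (m≤m+n _ _)))

      result : Σ[ u ∈ V ] Σ[ q ∈ Tour u a ] verts q ↭ all × k ≤ cyclic q c₂ × cyclic p a₂ < cyclic q a₂
      result with pivot
      ... | (u , v) , z∈ , 0<good , k+c≤ with reverse-prefix p z∈ | T-∧⁻ {adj a u} (0<χ⇒T 0<good)
      ...   | q , q↭ , exchange | au , bv = u , q , ↭-trans q↭ p↭
              , +-cancelʳ-≤ (c₂ (u , v)) k _ (begin
                  k + c₂ (u , v)                                          ≤⟨ k+c≤ ⟩
                  cyclic p c₂                                             ≤⟨ m≤m+n _ _ ⟩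
                  cyclic p c₂ + (c₂ (b , v) + c₂ (a , u))                 ≡⟨ exchange c₂ (χ-sym col-sym) ⟨
                  cyclic q c₂ + (c₂ (u , v) + c₂ (a , b))                 ≡⟨ cong (λ x → cyclic q c₂ + (c₂ (u , v) + x)) (χ-¬T (gap ∘ col⊆adj)) ⟩
                  cyclic q c₂ + (c₂ (u , v) + 0)                          ≡⟨ cong (cyclic q c₂ +_) (+-identityʳ _) ⟩
                  cyclic q c₂ + c₂ (u , v) ∎)
              , +-cancelʳ-≤ 1 _ _ (begin
                  suc (cyclic p a₂) + 1                                   ≡⟨ +-suc (cyclic p a₂) 1 ⟨
                  cyclic p a₂ + 2                                         ≡⟨ cong (cyclic p a₂ +_) (cong₂ _+_ (χ-T bv) (χ-T au)) ⟨
                  cyclic p a₂ + (a₂ (b , v) + a₂ (a , u))                 ≡⟨ exchange a₂ (χ-sym adj-sym) ⟨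
                  cyclic q a₂ + (a₂ (u , v) + a₂ (a , b))                 ≤⟨ +-monoʳ-≤ (cyclic q a₂) (+-mono-≤ (χ≤1 _) (≤-reflexive (χ-¬T gap))) ⟩
                  cyclic q a₂ + 1 ∎)
              where open ≤-Reasoning

    Hamiltonian : Set
    Hamiltonian = Σ[ a ∈ V ] Σ[ b ∈ V ] Σ[ p ∈ Tour a b ] verts p ↭ all × k ≤ cyclic p c₂ ×
                    T (adj b a) × (∀ z → z ∈ steps p → T (adj (proj₁ z) (proj₂ z)))

    cyclic≤n : ∀ {a b} (p : Tour a b) → verts p ↭ all → cyclic p a₂ ≤ length all
    cyclic≤n p p↭ = begin
      cyclic p a₂             ≤⟨ +-mono-≤ (∑-mono (steps p) {g = λ _ → 1} (λ _ → χ≤1 _)) (χ≤1 _) ⟩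
      ∑ (steps p) (λ _ → 1) + 1 ≡⟨ cong (_+ 1) (trans (∑-const (steps p) 1) (*-identityʳ _)) ⟩
      length (steps p) + 1    ≡⟨ +-comm _ 1 ⟩
      suc (length (steps p))  ≡⟨ trans (sym (↭-length p↭)) (length-verts p) ⟨
      length all ∎
      where open ≤-Reasoning

    find-gap : ∀ {a b} (p : Tour a b) →
               (Σ[ u ∈ V ] Σ[ v ∈ V ] Σ[ q ∈ Tour v u ] ¬ T (adj u v) × verts q ↭ verts p × (∀ f → cyclic q f ≡ cyclic p f)) ⊎
               (T (adj b a) × (∀ z → z ∈ steps p → T (adj (proj₁ z) (proj₂ z))))
    find-gap {a} {b} p with T? (adj b a)
    ... | no gap = inj₁ (b , a , p , gap , ↭-refl , λ _ → refl)
    ... | yes closed with ∀-⊎ (steps p) (λ { (u , v) z∈ → search u v z∈ })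
      where
      search : ∀ u v → (u , v) ∈ steps p → _ ⊎ T (adj u v)
      search u v z∈ with T? (adj u v)
      ... | yes uv = inj₂ uv
      ... | no gap = inj₁ (u , v , proj₁ (rotate p z∈) , gap , proj₂ (rotate p z∈))
    ...   | inj₁ gap = inj₁ gap
    ...   | inj₂ adjacent = inj₂ (closed , adjacent)

    -- The number of adjacent cyclic pairs never exceeds n and each repair raises it: two non-loop
    -- edges enter, while the gap and at most one edge leave. `fuel` bounds the pairs still missing.
    close-gaps : ∀ {a b} fuel (p : Tour a b) → length all ≤ fuel + cyclic p a₂ → verts p ↭ all → k ≤ cyclic p c₂ → Hamiltonian
    close-gaps fuel p enough p↭ k≤ with find-gap p
    ... | inj₂ (closed , adjacent) = _ , _ , p , p↭ , k≤ , closed , adjacent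
    ... | inj₁ (u , v , q , gap , q↭ , same) with close-gap q (↭-trans q↭ p↭) (≤-trans k≤ (≤-reflexive (sym (same c₂)))) gap
    close-gaps zero p enough p↭ k≤ | inj₁ (u , v , q , gap , q↭ , same) | _ , r , r↭ , k≤r , more =
      contradiction (≤-trans (≤-trans more (cyclic≤n r r↭)) (≤-trans enough (≤-reflexive (sym (same a₂))))) (<-irrefl refl)
    close-gaps (suc fuel) p enough p↭ k≤ | inj₁ (u , v , q , gap , q↭ , same) | _ , r , r↭ , k≤r , more =
      close-gaps fuel r (begin
        length all                ≤⟨ enough ⟩
        suc fuel + cyclic p a₂    ≡⟨ cong (suc fuel +_) (same a₂) ⟨
        suc fuel + cyclic q a₂    ≡⟨ +-suc fuel _ ⟨
        fuel + suc (cyclic q a₂)  ≤⟨ +-monoʳ-≤ fuel more ⟩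
        fuel + cyclic r a₂ ∎) r↭ k≤r
      where open ≤-Reasoning

    open LinearForest col col-sym (adj-irr ∘ col⊆adj) using (Forest; E; ∈-edges⁻)

    extend : Forest all k → 0 < length all → Hamiltonian
    extend ([] , ps↭ , k≤) 0<n = contradiction (≤-trans 0<n (≤-reflexive (sym (↭-length ps↭)))) λ ()
    extend (p ∷ ps , ps↭ , k≤) 0<n with concatenate p ps c₂
    ... | b , q , q≡ , le = close-gaps (length all) q (m≤m+n _ _) (↭-trans (↭-reflexive q≡) ps↭) (begin
        k                           ≤⟨ k≤ ⟩
        length (edges (p ∷ ps))     ≡⟨ trans (∑-const (edges (p ∷ ps)) 1) (*-identityʳ _) ⟨
        ∑ (edges (p ∷ ps)) (λ _ → 1) ≤⟨ ∑-mono (edges (p ∷ ps)) (λ z∈ → ≤-reflexive (sym (χ-T (coloured z∈)))) ⟩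
        ∑ (edges (p ∷ ps)) c₂       ≤⟨ le ⟩
        ∑ (steps q) c₂              ≤⟨ m≤m+n _ _ ⟩
        cyclic q c₂ ∎)
      where
      open ≤-Reasoning
      coloured : ∀ {z} → z ∈ edges (p ∷ ps) → E (proj₁ z) (proj₂ z)
      coloured z∈ with ∈-edges⁻ (p ∷ ps) z∈
      ... | r , _ , _ , z∈r with split (walk r) z∈r
      ...   | _ , e , _ = e

  -- From tours to Hamilton cycles

  module _ {n : ℕ} (G : Graph n) where
    open Graph G

    -- Both edges are stored with the smaller endpoint first, and their proof fields are irrelevant,
    -- so they agree definitionally once the comparisons are known.
    ⟦⟧-sym : ∀ {u v} (p : u ~ v) (q : v ~ u) → ⟦_⟧ G p ≡ ⟦_⟧ G q
    ⟦⟧-sym {u} {v} p q with <-cmp u v | <-cmp v u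
    ... | tri< _ _ _   | tri> _ _ _    = refl
    ... | tri> _ _ _   | tri< _ _ _    = refl
    ... | tri≈ _ refl _ | _            = contradiction p adj-irr
    ... | _            | tri≈ _ refl _ = contradiction p adj-irr
    ... | tri< u<v _ _ | tri< v<u _ _  = ⊥-elim (<-asym u<v v<u)
    ... | tri> _ _ v<u | tri> _ _ u<v  = ⊥-elim (<-asym u<v v<u)

    module _ {r : ℕ} (c : Colouring G r) (i : Fin r) where

      private
        -- The colour exists only on an adjacent pair. Abstracting the Boolean lets it be matched on
        -- while the colour still depends on its proof.
        has : (b : Bool) → (T b → Fin r) → Bool
        has true  f = does (f tt ≟ i)
        has false f = false

        has-≡ : ∀ b f (p : T b) → has b f ≡ does (f p ≟ i)
        has-≡ true f p = refl

        has⇒T : ∀ b f → T (has b f) → T b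
        has⇒T true f _ = tt

      coloured : Fin n → Fin n → Bool
      coloured u v = has (adj u v) (λ p → c (⟦_⟧ G p))

      coloured-≡ : ∀ {u v} (p : u ~ v) → coloured u v ≡ does (c (⟦_⟧ G p) ≟ i)
      coloured-≡ {u} {v} p = has-≡ (adj u v) _ p

      coloured⇒~ : ∀ {u v} → T (coloured u v) → u ~ v
      coloured⇒~ {u} {v} = has⇒T (adj u v) _

      coloured-sym : ∀ {u v} → T (coloured u v) → T (coloured v u)
      coloured-sym {u} {v} uv = subst T
        (trans (coloured-≡ p) (trans (cong (λ e → does (c e ≟ i)) (⟦⟧-sym p (adj-sym p))) (sym (coloured-≡ (adj-sym p))))) uv
        where p = coloured⇒~ {u} {v} uv

    edge-coloured : ∀ {r} (c : Colouring G r) {u v} (p : u ~ v) → T (coloured c (c (⟦_⟧ G p)) u v)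
    edge-coloured c p = subst T (sym (trans (coloured-≡ c _ p) (dec-true (c (⟦_⟧ G p) ≟ c (⟦_⟧ G p)) refl))) tt

  length-filter-χ : ∀ {A : Set} {P : A → Set} (P? : Decidable P) xs → length (filter P? xs) ≡ ∑[ x ∈ xs ] χ (does (P? x))
  length-filter-χ P? [] = refl
  length-filter-χ P? (x ∷ xs) with does (P? x)
  ... | true  = cong suc (length-filter-χ P? xs)
  ... | false = length-filter-χ P? xs

  Unique⇒injective : ∀ {A : Set} {n} (f : Fin n → A) → Unique (tabulate f) → ∀ i j → f i ≡ f j → i ≡ j
  Unique⇒injective f _            zero    zero    _  = refl
  Unique⇒injective f (f0∉ ∷ _)    zero    (suc j) eq = contradiction eq (All.lookup f0∉ (∈-tabulate⁺ j))
  Unique⇒injective f (f0∉ ∷ _)    (suc i) zero    eq = contradiction (sym eq) (All.lookup f0∉ (∈-tabulate⁺ i))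
  Unique⇒injective f (_   ∷ uniq) (suc i) (suc j) eq = cong suc (Unique⇒injective (f ∘ suc) uniq i j eq)

  -- Isolates the position at which `next` wraps round to zero; it carries the closing term of
  -- `cyclic`.
  sum-tabulate-last : ∀ {m} (h : Fin (suc m) → ℕ) → sum (tabulate h) ≡ sum (tabulate (h ∘ inject₁)) + h (fromℕ m)
  sum-tabulate-last {zero}  h = +-identityʳ _
  sum-tabulate-last {suc m} h = trans (cong (h zero +_) (sum-tabulate-last (h ∘ suc))) (sym (+-assoc (h zero) _ _))

  next-inject₁ : ∀ {m} (j : Fin m) → next (inject₁ j) ≡ suc j
  next-inject₁ {m} j = toℕ-injective (trans (toℕ-fromℕ< (m%n<n (suc (toℕ (inject₁ j))) (suc m)))
    (trans (cong (λ x → suc x % suc m) (toℕ-inject₁ j)) (m<n⇒m%n≡m (s≤s (toℕ<n j)))))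

  next-fromℕ : ∀ m → next (fromℕ m) ≡ zero
  next-fromℕ m = toℕ-injective (trans (toℕ-fromℕ< (m%n<n (suc (toℕ (fromℕ m))) (suc m)))
    (trans (cong (λ x → suc x % suc m) (toℕ-fromℕ m)) (n%n≡0 (suc m))))

  module _ {V : Set} where

    at : ∀ {a b} (p : Tour {V} a b) → Fin (suc (length (steps p))) → V
    at [ v ]        _       = v
    at (step u _ p) zero    = u
    at (step u _ p) (suc i) = at p i

    at-first : ∀ {a b} (p : Tour {V} a b) → at p zero ≡ a
    at-first [ v ]        = refl
    at-first (step u _ p) = refl

    at-last : ∀ {a b} (p : Tour {V} a b) → at p (fromℕ _) ≡ b
    at-last [ v ]        = refl
    at-last (step u _ p) = at-last p

    tabulate-at : ∀ {a b} (p : Tour {V} a b) → tabulate (at p) ≡ verts p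
    tabulate-at [ v ]        = refl
    tabulate-at (step u _ p) = cong (u ∷_) (tabulate-at p)

    tabulate-steps : ∀ {a b} (p : Tour {V} a b) → tabulate (λ j → at p (inject₁ j) , at p (suc j)) ≡ steps p
    tabulate-steps [ v ]        = refl
    tabulate-steps (step u _ p) = cong₂ _∷_ (cong (u ,_) (at-first p)) (tabulate-steps p)

  -- The inverse of `f` is read off from membership of each vertex in `tabulate f`; `f` is injective
  -- since a permutation of `allFin n` has no repetition.
  toCycle : ∀ {n m r} (G : Graph n) (c : Colouring G r) i (f : Fin (suc m) → Fin n) → suc m ≡ n → 3 ≤ n →
            tabulate f ↭ allFin n → let open Graph G in
            (∀ j → f (inject₁ j) ~ f (suc j)) → f (fromℕ m) ~ f zero →
            Σ[ H ∈ HamiltonCycle G ] HamiltonCycle.edgesOfColour H c i ≡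
              sum (tabulate λ j → χ (coloured G c i (f (inject₁ j)) (f (suc j)))) + χ (coloured G c i (f (fromℕ m)) (f zero))
  toCycle {m = m} G c i f refl 3≤n f↭ inner closing = H , count
    where
    open Graph G
    g : Fin (suc m) → Fin (suc m)
    g v = proj₁ (∈-tabulate⁻ {f = f} (∈-resp-↭ (↭-sym f↭) (∈-allFin v)))
    fg : ∀ v → f (g v) ≡ v
    fg v = sym (proj₂ (∈-tabulate⁻ {f = f} (∈-resp-↭ (↭-sym f↭) (∈-allFin v))))
    f-inj : ∀ i j → f i ≡ f j → i ≡ j
    f-inj = Unique⇒injective f (Permₛ.Unique-resp-↭ (setoid _) (↭⇒↭ₛ (↭-sym f↭)) (allFin⁺ _))

    adjacent : ∀ j → f j ~ f (next j)
    adjacent j with view j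
    ... | ‵fromℕ     = subst (λ k → f (fromℕ m) ~ f k) (sym (next-fromℕ m)) closing
    ... | ‵inject₁ j = subst (λ k → f (inject₁ j) ~ f k) (sym (next-inject₁ j)) (inner j)

    H : HamiltonCycle G
    H = record { n≥3 = 3≤n ; order = permutation f g fg (λ j → f-inj _ _ (fg (f j))) ; consecutive = adjacent }

    colour : Fin (suc m) → ℕ
    colour j = χ (coloured G c i (f j) (f (next j)))

    count : HamiltonCycle.edgesOfColour H c i ≡
            sum (tabulate λ j → χ (coloured G c i (f (inject₁ j)) (f (suc j)))) + χ (coloured G c i (f (fromℕ m)) (f zero))
    count = begin
      HamiltonCycle.edgesOfColour H c i
        ≡⟨ length-filter-χ (λ j → c (HamiltonCycle.cycleEdge H j) ≟ i) (allFin _) ⟩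
      ∑[ j ∈ allFin _ ] χ (does (c (HamiltonCycle.cycleEdge H j) ≟ i))
        ≡⟨ ∑-cong (allFin _) (λ j → cong χ (sym (coloured-≡ G c i (adjacent j)))) ⟩
      ∑ (allFin _) colour
        ≡⟨ cong sum (map-tabulate id colour) ⟩
      sum (tabulate colour)
        ≡⟨ sum-tabulate-last colour ⟩
      sum (tabulate (colour ∘ inject₁)) + colour (fromℕ m)
        ≡⟨ cong₂ _+_
             (cong sum (tabulate-cong λ j → cong (λ k → χ (coloured G c i (f (inject₁ j)) (f k))) (next-inject₁ j)))
             (cong (λ k → χ (coloured G c i (f (fromℕ m)) (f k))) (next-fromℕ m)) ⟩
      sum (tabulate λ j → χ (coloured G c i (f (inject₁ j)) (f (suc j)))) + χ (coloured G c i (f (fromℕ m)) (f zero)) ∎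
      where open ≡-Reasoning

  module _ {n r : ℕ} (G : Graph n) (c : Colouring G r) (i : Fin r) (k : ℕ) where
    open Graph G

    hamiltonCycle : (∀ v → length (allFin n) + k ≤ 2 * (∑[ u ∈ allFin n ] χ (adj v u))) → 3 ≤ n →
                    LinearForest.Forest (coloured G c i) (coloured-sym G c i) (λ vv → adj-irr (coloured⇒~ G c i vv)) (allFin n) k →
                    Σ[ H ∈ HamiltonCycle G ] k ≤ HamiltonCycle.edgesOfColour H c i
    hamiltonCycle degree-bound 3≤n forest = fromTour (extend forest (≤-trans (s≤s z≤n) (≤-trans 3≤n (≤-reflexive (sym length-allFin)))))
      where
      open Posa adj adj-sym adj-irr (coloured G c i) (coloured-sym G c i) (coloured⇒~ G c i) (allFin n) k degree-bound
      length-allFin : length (allFin n) ≡ n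
      length-allFin = length-tabulate id

      fromTour : Hamiltonian → Σ[ H ∈ HamiltonCycle G ] k ≤ HamiltonCycle.edgesOfColour H c i
      fromTour (a , b , p , p↭ , k≤ , closed , adjacent)
        with toCycle G c i (at p) (trans (sym (length-verts p)) (trans (↭-length p↭) length-allFin)) 3≤n
               (↭-trans (↭-reflexive (tabulate-at p)) p↭)
               (λ j → adjacent _ (subst ((at p (inject₁ j) , at p (suc j)) ∈_) (tabulate-steps p)
                 (∈-tabulate⁺ {f = λ j → at p (inject₁ j) , at p (suc j)} j)))
               (subst₂ _~_ (sym (at-last p)) (sym (at-first p)) closed)
      ... | H , count = H , ≤-trans k≤ (≤-reflexive (sym (trans count (cong₂ _+_
               (cong sum (trans (sym (map-tabulate _ c₂)) (cong (map c₂) (tabulate-steps p))))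
               (cong₂ (λ x y → χ (coloured G c i x y)) (at-last p) (at-first p))))))

  -- Counting edges outside all the sets Sᵢ

  χ-all-or-some : ∀ {I : Set} (S : I → Bool) is → 1 ≤ χ (Bool.all (not ∘ S) is) + (∑[ i ∈ is ] χ (S i))
  χ-all-or-some S []       = ≤-refl
  χ-all-or-some S (i ∷ is) with S i
  ... | true  = s≤s z≤n
  ... | false = χ-all-or-some S is

  χ*χ*χ≤ : ∀ a b c {x} → (T a → T b → T c → 1 ≤ x) → χ a * (χ b * χ c) ≤ x
  χ*χ*χ≤ false b     c     h = z≤n
  χ*χ*χ≤ true  false c     h = z≤n
  χ*χ*χ≤ true  true  false h = z≤n
  χ*χ*χ≤ true  true  true  h = h tt tt tt

  module DoubleCount {V I : Set} (all : List V) (colours : List I) (adj : V → V → Bool) (e : I → V → V → Bool)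
           (coloured : ∀ {u v} → T (adj u v) → ∃[ i ] i ∈ colours × T (e i u v))
           (k : ℕ) (S : I → V → Bool)
           (small  : ∀ i → 2 * (∑[ v ∈ all ] χ (S i v)) ≤ k)
           (sparse : ∀ i → (∑[ u ∈ all ] ∑[ v ∈ all ] χ (not (S i u)) * (χ (not (S i v)) * χ (e i u v)))
                             + 2 * k * (∑[ v ∈ all ] χ (S i v)) ≤ k * k + 6 * length all)
           (degree-bound : ∀ v → length all + k ≤ 2 * (∑[ u ∈ all ] χ (adj v u))) where

    private
      n r : ℕ
      n = length all
      r = length colours

      W : V → Bool
      W v = Bool.all (λ i → not (S i v)) colours

      w : V → ℕ
      w v = χ (W v)

      s X : I → ℕ
      s i = ∑[ v ∈ all ] χ (S i v)
      X i = ∑[ u ∈ all ] ∑[ v ∈ all ] χ (not (S i u)) * (χ (not (S i v)) * χ (e i u v))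

      A′ : V → ℕ
      A′ u = ∑[ v ∈ all ] w v * χ (adj u v)

    m σ : ℕ
    m = ∑ all w
    σ = ∑ colours s

    private
      W⇒∉S : ∀ {v i} → T (W v) → i ∈ colours → T (not (S i v))
      W⇒∉S {v} Wv i∈ = All.lookup (all⁺ (λ i → not (S i v)) colours Wv) i∈

    n≤m+σ : n ≤ m + σ
    n≤m+σ = begin
      n                                                       ≡⟨ trans (∑-const all 1) (*-identityʳ n) ⟨
      ∑ all (λ _ → 1)                                         ≤⟨ ∑-mono all (λ {v} _ → χ-all-or-some (λ i → S i v) colours) ⟩
      (∑[ v ∈ all ] (w v + (∑[ i ∈ colours ] χ (S i v))))     ≡⟨ ∑-+ all w _ ⟩
      m + (∑[ v ∈ all ] ∑[ i ∈ colours ] χ (S i v))           ≡⟨ cong (m +_) (∑-swap all colours (λ v i → χ (S i v))) ⟩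
      m + σ ∎
      where open ≤-Reasoning

    2σ≤rk : 2 * σ ≤ r * k
    2σ≤rk = begin
      2 * σ                        ≡⟨ ∑-*ˡ colours 2 s ⟨
      (∑[ i ∈ colours ] 2 * s i)   ≤⟨ ∑-mono colours (λ {i} _ → small i) ⟩
      ∑ colours (λ _ → k)          ≡⟨ ∑-const colours k ⟩
      r * k ∎
      where open ≤-Reasoning

    private
      -- Only n - m vertices lie outside W, so at least deg u - (n - m) neighbours of u are in W;
      -- this is doubled and combined with 2 deg u ≥ n + k.
      inside : ∀ u → k + 2 * m ≤ 2 * A′ u + n
      inside u = +-cancelˡ-≤ n _ _ (begin
        n + (k + 2 * m)                  ≡⟨ +-assoc n k _ ⟨
        n + k + 2 * m                    ≤⟨ +-monoˡ-≤ (2 * m) (degree-bound u) ⟩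
        2 * d + 2 * m                    ≡⟨ *-distribˡ-+ 2 d m ⟨
        2 * (d + m)                      ≤⟨ *-monoʳ-≤ 2 d+m≤ ⟩
        2 * (A′ u + n)                   ≡⟨ lem (A′ u) n ⟩
        n + (2 * A′ u + n) ∎)
        where
        open ≤-Reasoning
        d = ∑[ v ∈ all ] χ (adj u v)
        lem : ∀ a n → 2 * (a + n) ≡ n + (2 * a + n)
        lem = solve-∀
        pointwise : ∀ a b → χ a + χ b ≤ χ b * χ a + 1
        pointwise true  true  = ≤-refl
        pointwise true  false = ≤-refl
        pointwise false true  = ≤-refl
        pointwise false false = z≤n
        d+m≤ : d + m ≤ A′ u + n
        d+m≤ = begin
          d + m                                           ≡⟨ ∑-+ all (λ v → χ (adj u v)) w ⟨
          (∑[ v ∈ all ] (χ (adj u v) + w v))              ≤⟨ ∑-mono all (λ {v} _ → pointwise (adj u v) (W v)) ⟩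
          (∑[ v ∈ all ] (w v * χ (adj u v) + 1))          ≡⟨ ∑-+ all (λ v → w v * χ (adj u v)) (λ _ → 1) ⟩
          A′ u + ∑ all (λ _ → 1)                          ≡⟨ cong (A′ u +_) (trans (∑-const all 1) (*-identityʳ n)) ⟩
          A′ u + n ∎

      -- An edge within W has some colour i, and its ends avoid this Sᵢ in particular, so it is
      -- counted in `X i`.
      edges-inside : (∑[ u ∈ all ] w u * A′ u) ≤ ∑ colours X
      edges-inside = begin
        (∑[ u ∈ all ] w u * A′ u)
          ≡⟨ ∑-cong all (λ u → sym (∑-*ˡ all (w u) _)) ⟩
        (∑[ u ∈ all ] ∑[ v ∈ all ] w u * (w v * χ (adj u v)))
          ≤⟨ ∑-mono all (λ {u} _ → ∑-mono all (λ {v} _ → χ*χ*χ≤ (W u) (W v) (adj u v) (covered u v))) ⟩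
        (∑[ u ∈ all ] ∑[ v ∈ all ] ∑[ i ∈ colours ] F i u v)
          ≡⟨ ∑-cong all (λ u → ∑-swap all colours (λ v i → F i u v)) ⟩
        (∑[ u ∈ all ] ∑[ i ∈ colours ] ∑[ v ∈ all ] F i u v)
          ≡⟨ ∑-swap all colours (λ u i → ∑[ v ∈ all ] F i u v) ⟩
        ∑ colours X ∎
        where
        open ≤-Reasoning
        F : I → V → V → ℕ
        F i u v = χ (not (S i u)) * (χ (not (S i v)) * χ (e i u v))
        covered : ∀ u v → T (W u) → T (W v) → T (adj u v) → 1 ≤ (∑[ i ∈ colours ] F i u v)
        covered u v Wu Wv uv = let i , i∈ , iuv = coloured uv in
          ≤-trans (≤-reflexive (sym (cong₂ _*_ (χ-T (W⇒∉S {u} Wu i∈)) (cong₂ _*_ (χ-T (W⇒∉S {v} Wv i∈)) (χ-T iuv)))))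
            (term≤∑ (λ i → F i u v) i∈)

    -- Twice the ordered edges within W, bounded below by degrees and above by colours. The term 4kσ
    -- is added on both sides so that `sparse` can be applied to each colour as it stands.
    edge-count : m * (k + 2 * m) + 4 * k * σ ≤ 2 * (r * (k * k + 6 * n)) + m * n
    edge-count = begin
      m * (k + 2 * m) + 4 * k * σ
        ≡⟨ cong (_+ 4 * k * σ) (∑-*ʳ all (k + 2 * m) w) ⟨
      (∑[ u ∈ all ] w u * (k + 2 * m)) + 4 * k * σ
        ≤⟨ +-monoˡ-≤ (4 * k * σ) (∑-mono all (λ {u} _ → *-monoʳ-≤ (w u) (inside u))) ⟩
      (∑[ u ∈ all ] w u * (2 * A′ u + n)) + 4 * k * σ
        ≡⟨ cong (_+ 4 * k * σ) (trans (∑-cong all (λ u → l₁ (w u) (A′ u) n))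
             (trans (∑-+ all (λ u → 2 * (w u * A′ u)) (λ u → w u * n)) (cong₂ _+_ (∑-*ˡ all 2 (λ u → w u * A′ u)) (∑-*ʳ all n w)))) ⟩
      2 * (∑[ u ∈ all ] w u * A′ u) + m * n + 4 * k * σ
        ≤⟨ +-monoˡ-≤ (4 * k * σ) (+-monoˡ-≤ (m * n) (*-monoʳ-≤ 2 edges-inside)) ⟩
      2 * ∑ colours X + m * n + 4 * k * σ
        ≡⟨ l₂ (∑ colours X) (m * n) k σ ⟩
      2 * (∑ colours X + 2 * k * σ) + m * n
        ≡⟨ cong (λ x → 2 * (∑ colours X + x) + m * n) (∑-*ˡ colours (2 * k) s) ⟨
      2 * (∑ colours X + (∑[ i ∈ colours ] 2 * k * s i)) + m * n
        ≡⟨ cong (λ x → 2 * x + m * n) (∑-+ colours X (λ i → 2 * k * s i)) ⟨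
      2 * (∑[ i ∈ colours ] (X i + 2 * k * s i)) + m * n
        ≤⟨ +-monoˡ-≤ (m * n) (*-monoʳ-≤ 2 (∑-mono colours (λ {i} _ → sparse i))) ⟩
      2 * ∑ colours (λ _ → k * k + 6 * n) + m * n
        ≡⟨ cong (λ x → 2 * x + m * n) (∑-const colours (k * k + 6 * n)) ⟩
      2 * (r * (k * k + 6 * n)) + m * n ∎
      where
      open ≤-Reasoning
      l₁ : ∀ w a n → w * (2 * a + n) ≡ 2 * (w * a) + w * n
      l₁ = solve-∀
      l₂ : ∀ x y k s → 2 * x + y + 4 * k * s ≡ 2 * (x + 2 * k * s) + y
      l₂ = solve-∀

  -- Numerical contradiction from the double count

  2xy≤x²+y² : ∀ x y → 2 * (x * y) ≤ x * x + y * y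
  2xy≤x²+y² x y with ≤-total x y
  ... | inj₁ x≤y with m≤n⇒∃[o]m+o≡n x≤y
  ...   | d , refl = ≤-trans (m≤m+n _ (d * d)) (≤-reflexive (lem x d))
    where
    lem : ∀ x d → 2 * (x * (x + d)) + d * d ≡ x * x + (x + d) * (x + d)
    lem = solve-∀
  2xy≤x²+y² x y | inj₂ y≤x with m≤n⇒∃[o]m+o≡n y≤x
  ...   | d , refl = ≤-trans (m≤m+n _ (d * d)) (≤-reflexive (lem y d))
    where
    lem : ∀ y d → 2 * ((y + d) * y) + d * d ≡ (y + d) * (y + d) + y * y
    lem = solve-∀

  module _ {r n k e m σ : ℕ} (2≤r : 2 ≤ r) (rk≡ : r * k ≡ n + e) (e-small : 14 * (r * e) ≤ n + 14 * (r * r))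
           (n-large : 96 * (r * r) ≤ n) (n≤m+σ : n ≤ m + σ) (2σ≤rk : 2 * σ ≤ r * k)
           (count : m * (k + 2 * m) + 4 * k * σ ≤ 2 * (r * (k * k + 6 * n)) + m * n) where

    private
      open ≤-Reasoning
      instance
        r≢0 : NonZero r
        r≢0 = >-nonZero (≤-trans (s≤s z≤n) 2≤r)

      c*rr≤n : ∀ c → c ≤ 96 → c * (r * r) ≤ n
      c*rr≤n c c≤ = ≤-trans (*-monoˡ-≤ (r * r) c≤) n-large

      0<n : 0 < n
      0<n = ≤-trans (*-mono-≤ {1} {96} (s≤s z≤n) (*-mono-≤ {1} {r} {1} {r} (<⇒≤ 2≤r) (<⇒≤ 2≤r))) n-large

      n≤rk : n ≤ r * k
      n≤rk = ≤-trans (m≤m+n n e) (≤-reflexive (sym rk≡))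

      96r≤k : 96 * r ≤ k
      96r≤k = *-cancelˡ-≤ r (begin
        r * (96 * r)   ≡⟨ lem r ⟩
        96 * (r * r)   ≤⟨ n-large ⟩
        n              ≤⟨ n≤rk ⟩
        r * k ∎)
        where
        lem : ∀ r → r * (96 * r) ≡ 96 * (r * r)
        lem = solve-∀

      4e≤k : 4 * e ≤ k
      4e≤k = *-cancelˡ-≤ 2 (≤-trans 2[4e]≤14e (*-cancelˡ-≤ r (begin
        r * (14 * e)          ≡⟨ lem r e ⟩
        14 * (r * e)          ≤⟨ e-small ⟩
        n + 14 * (r * r)      ≤⟨ +-mono-≤ n≤rk (≤-trans (c*rr≤n 14 (m≤m+n 14 82)) n≤rk) ⟩
        r * k + r * k         ≡⟨ lem₂ r k ⟩
        r * (2 * k) ∎)))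
        where
        lem : ∀ r e → r * (14 * e) ≡ 14 * (r * e)
        lem = solve-∀
        lem₂ : ∀ r k → r * k + r * k ≡ r * (2 * k)
        lem₂ = solve-∀
        2[4e]≤14e : 2 * (4 * e) ≤ 14 * e
        2[4e]≤14e = ≤-trans (≤-reflexive (sym (*-assoc 2 4 e))) (*-monoˡ-≤ e (m≤m+n 8 6))

      16e≤n : 16 * e ≤ n
      16e≤n = *-cancelˡ-≤ 7 (begin
        7 * (16 * e)                 ≤⟨ *-monoʳ-≤ 7 (*-monoˡ-≤ e (m≤m+n 16 8)) ⟩
        7 * (24 * e)                 ≡⟨ lem₁ e ⟩
        84 * (2 * e)                 ≤⟨ *-monoʳ-≤ 84 (*-monoˡ-≤ e 2≤r) ⟩
        84 * (r * e)                 ≡⟨ lem₂ (r * e) ⟩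
        6 * (14 * (r * e))           ≤⟨ *-monoʳ-≤ 6 e-small ⟩
        6 * (n + 14 * (r * r))       ≡⟨ lem₃ n (r * r) ⟩
        6 * n + 84 * (r * r)         ≤⟨ +-monoʳ-≤ (6 * n) (c*rr≤n 84 (m≤m+n 84 12)) ⟩
        6 * n + n                    ≡⟨ +-comm (6 * n) n ⟩
        7 * n ∎)
        where
        lem₁ : ∀ e → 7 * (24 * e) ≡ 84 * (2 * e)
        lem₁ = solve-∀
        lem₂ : ∀ x → 84 * x ≡ 6 * (14 * x)
        lem₂ = solve-∀
        lem₃ : ∀ n x → 6 * (n + 14 * x) ≡ 6 * n + 84 * x
        lem₃ = solve-∀

      0<kn : 0 < k * n
      0<kn = *-mono-≤ {1} {k} (≤-trans (*-mono-≤ {1} {96} (s≤s z≤n) (<⇒≤ 2≤r)) 96r≤k) 0<n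

      16ke≤kn : 16 * (k * e) ≤ k * n
      16ke≤kn = ≤-trans (≤-reflexive (lem k e)) (*-monoʳ-≤ k 16e≤n)
        where
        lem : ∀ k e → 16 * (k * e) ≡ k * (16 * e)
        lem = solve-∀

      96rn≤kn : 96 * (r * n) ≤ k * n
      96rn≤kn = ≤-trans (≤-reflexive (sym (*-assoc 96 r n))) (*-monoˡ-≤ n 96r≤k)

      4ne≤kn : 4 * (n * e) ≤ k * n
      4ne≤kn = ≤-trans (≤-reflexive (lem n e)) (*-monoˡ-≤ n 4e≤k)
        where
        lem : ∀ n e → 4 * (n * e) ≡ (4 * e) * n
        lem = solve-∀

      -- `count` after eliminating σ by σ ≥ n - m and rk by n + e: apart from the errors 2ke and
      -- 12rn it says 2m² - (n + 3k)m + 2kn ≤ 0.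
      quadratic : 2 * (m * m) + 2 * (k * n) ≤ 2 * (k * e) + 12 * (r * n) + m * n + 3 * (k * m)
      quadratic = +-cancelˡ-≤ (k * m + 4 * (k * σ) + 2 * (k * n)) _ _ (begin
        k * m + 4 * (k * σ) + 2 * (k * n) + (2 * (m * m) + 2 * (k * n))
          ≡⟨ lem₁ m k n σ ⟩
        m * (k + 2 * m) + 4 * k * σ + 4 * k * n
          ≤⟨ +-mono-≤ count (*-monoʳ-≤ (4 * k) n≤m+σ) ⟩
        2 * (r * (k * k + 6 * n)) + m * n + 4 * k * (m + σ)
          ≡⟨ lem₂ r m k n σ ⟩
        2 * (k * (r * k)) + 12 * (r * n) + m * n + 4 * k * (m + σ)
          ≡⟨ cong (λ x → 2 * (k * x) + 12 * (r * n) + m * n + 4 * k * (m + σ)) rk≡ ⟩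
        2 * (k * (n + e)) + 12 * (r * n) + m * n + 4 * k * (m + σ)
          ≡⟨ lem₃ r m k n e σ ⟩
        k * m + 4 * (k * σ) + 2 * (k * n) + (2 * (k * e) + 12 * (r * n) + m * n + 3 * (k * m)) ∎)
        where
        lem₁ : ∀ m k n s → k * m + 4 * (k * s) + 2 * (k * n) + (2 * (m * m) + 2 * (k * n)) ≡ m * (k + 2 * m) + 4 * k * s + 4 * k * n
        lem₁ = solve-∀
        lem₂ : ∀ r m k n s → 2 * (r * (k * k + 6 * n)) + m * n + 4 * k * (m + s) ≡ 2 * (k * (r * k)) + 12 * (r * n) + m * n + 4 * k * (m + s)
        lem₂ = solve-∀
        lem₃ : ∀ r m k n e s → 2 * (k * (n + e)) + 12 * (r * n) + m * n + 4 * k * (m + s) ≡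
                 k * m + 4 * (k * s) + 2 * (k * n) + (2 * (k * e) + 12 * (r * n) + m * n + 3 * (k * m))
        lem₃ = solve-∀

      -- Near m = n/2 the quadratic still has margin kn/2. Doubled, it is at most the three errors
      -- in `kn≤`; four times these come to at most 3kn, one kn short of what is needed.
      below : ∀ y → 2 * m + y ≡ n → ⊥
      below y refl = <⇒≱ 0<kn (+-cancelˡ-≤ (3 * (k * n)) _ _ (begin
        3 * (k * n) + k * n                                     ≡⟨ lem₁ (k * n) ⟩
        4 * (k * n)                                             ≤⟨ *-monoʳ-≤ 4 kn≤ ⟩
        4 * (4 * (k * e) + 24 * (r * n) + n * e)                ≡⟨ lem₂ (k * e) (r * n) (n * e) ⟩
        16 * (k * e) + 96 * (r * n) + 4 * (n * e)               ≤⟨ +-mono-≤ (+-mono-≤ 16ke≤kn 96rn≤kn) 4ne≤kn ⟩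
        k * n + k * n + k * n                                   ≡⟨ lem₃ (k * n) ⟩
        3 * (k * n) + 0 ∎))
        where
        lem₁ : ∀ x → 3 * x + x ≡ 4 * x
        lem₁ = solve-∀
        lem₂ : ∀ x y z → 4 * (4 * x + 24 * y + z) ≡ 16 * x + 96 * y + 4 * z
        lem₂ = solve-∀
        lem₃ : ∀ x → x + x + x ≡ 3 * x + 0
        lem₃ = solve-∀
        lem₄ : ∀ m y k x → 4 * (m * m) + 3 * (k * (2 * m + y)) + k * (2 * m + y) ≡ 2 * (2 * (m * m) + 2 * (k * (2 * m + y)))
        lem₄ = solve-∀
        lem₅ : ∀ m y k a b → 2 * (2 * a + 12 * b + m * (2 * m + y) + 3 * (k * m)) ≡ 4 * (m * m) + 3 * (k * (2 * m)) + (4 * a + 24 * b + 2 * m * y)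
        lem₅ = solve-∀
        lem₆ : ∀ m s → 2 * (m + s) ≡ 2 * m + 2 * s
        lem₆ = solve-∀
        lem₇ : ∀ m y e → 2 * m + (2 * m + y + e) ≡ 2 * m + y + (2 * m + e)
        lem₇ = solve-∀
        lem₈ : ∀ n → n + n ≡ 2 * n
        lem₈ = solve-∀
        -- From 2σ ≤ rk = n + e: the vertices outside all Sᵢ fall short of n/2 by at most e/2.
        y≤e : y ≤ e
        y≤e = +-cancelˡ-≤ (2 * m) _ _ (+-cancelˡ-≤ n _ _ (begin
          n + n                    ≡⟨ lem₈ n ⟩
          2 * n                    ≤⟨ *-monoʳ-≤ 2 n≤m+σ ⟩
          2 * (m + σ)              ≡⟨ lem₆ m σ ⟩
          2 * m + 2 * σ            ≤⟨ +-monoʳ-≤ (2 * m) (≤-trans 2σ≤rk (≤-reflexive rk≡)) ⟩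
          2 * m + (n + e)          ≡⟨ lem₇ m y e ⟩
          n + (2 * m + e) ∎))
        kn≤ : k * n ≤ 4 * (k * e) + 24 * (r * n) + n * e
        kn≤ = +-cancelˡ-≤ (4 * (m * m) + 3 * (k * n)) _ _ (begin
          4 * (m * m) + 3 * (k * n) + k * n
            ≡⟨ lem₄ m y k 0 ⟩
          2 * (2 * (m * m) + 2 * (k * n))
            ≤⟨ *-monoʳ-≤ 2 quadratic ⟩
          2 * (2 * (k * e) + 12 * (r * n) + m * n + 3 * (k * m))
            ≡⟨ lem₅ m y k (k * e) (r * n) ⟩
          4 * (m * m) + 3 * (k * (2 * m)) + (4 * (k * e) + 24 * (r * n) + 2 * m * y)
            ≤⟨ +-mono-≤ (+-monoʳ-≤ (4 * (m * m)) (*-monoʳ-≤ 3 (*-monoʳ-≤ k (m≤m+n (2 * m) y))))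
                 (+-monoʳ-≤ (4 * (k * e) + 24 * (r * n)) (*-mono-≤ (m≤m+n (2 * m) y) y≤e)) ⟩
          4 * (m * m) + 3 * (k * n) + (4 * (k * e) + 24 * (r * n) + n * e) ∎)

      above : ∀ y → n + y ≡ 2 * m → ⊥
      above y n+y≡2m = [ k-small , k-large ]′ (≤-<-connex (3 * k) n)
        where
        lem₁ : ∀ n y k → 4 * (n * n + n * y) + 12 * (k * n) + (4 * (n * y) + 4 * (y * y) + 2 * (k * n)) + 2 * (k * n) ≡
                         4 * ((n + y) * (n + y) + 4 * (k * n))
        lem₁ = solve-∀
        lem₂ : ∀ m x → 2 * m * (2 * m) + 4 * x ≡ 2 * (2 * (m * m) + 2 * x)
        lem₂ = solve-∀
        lem₃ : ∀ m n k a b → 4 * (2 * (2 * a + 12 * b + m * n + 3 * (k * m))) ≡ 16 * a + 96 * b + 4 * (n * (2 * m)) + 12 * (k * (2 * m))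
        lem₃ = solve-∀
        lem₄ : ∀ n y k → k * n + k * n + 4 * (n * (n + y)) + 12 * (k * (n + y)) ≡
                         4 * (n * n + n * y) + 12 * (k * n) + 12 * (k * y) + 2 * (k * n)
        lem₄ = solve-∀
        -- Eight times `quadratic`, rewritten in y = 2m - n; the two errors together use up 2kn of
        -- the constant term.
        main : 4 * (n * y) + 4 * (y * y) + 2 * (k * n) ≤ 12 * (k * y)
        main = +-cancelˡ-≤ (4 * (n * n + n * y) + 12 * (k * n)) _ _ (+-cancelʳ-≤ (2 * (k * n)) _ _ (begin
          4 * (n * n + n * y) + 12 * (k * n) + (4 * (n * y) + 4 * (y * y) + 2 * (k * n)) + 2 * (k * n)
            ≡⟨ lem₁ n y k ⟩
          4 * ((n + y) * (n + y) + 4 * (k * n))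
            ≡⟨ cong (λ x → 4 * (x * x + 4 * (k * n))) n+y≡2m ⟩
          4 * (2 * m * (2 * m) + 4 * (k * n))
            ≡⟨ cong (4 *_) (lem₂ m (k * n)) ⟩
          4 * (2 * (2 * (m * m) + 2 * (k * n)))
            ≤⟨ *-monoʳ-≤ 4 (*-monoʳ-≤ 2 quadratic) ⟩
          4 * (2 * (2 * (k * e) + 12 * (r * n) + m * n + 3 * (k * m)))
            ≡⟨ lem₃ m n k (k * e) (r * n) ⟩
          16 * (k * e) + 96 * (r * n) + 4 * (n * (2 * m)) + 12 * (k * (2 * m))
            ≤⟨ +-monoˡ-≤ (12 * (k * (2 * m))) (+-monoˡ-≤ (4 * (n * (2 * m))) (+-mono-≤ 16ke≤kn 96rn≤kn)) ⟩
          k * n + k * n + 4 * (n * (2 * m)) + 12 * (k * (2 * m))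
            ≡⟨ cong (λ x → k * n + k * n + 4 * (n * x) + 12 * (k * x)) n+y≡2m ⟨
          k * n + k * n + 4 * (n * (n + y)) + 12 * (k * (n + y))
            ≡⟨ lem₄ n y k ⟩
          4 * (n * n + n * y) + 12 * (k * n) + 12 * (k * y) + 2 * (k * n) ∎))

        -- The quadratic 4y² + 4(n - 3k)y + 2kn has no negative coefficient here, so it is positive
        -- for all y ≥ 0.
        k-small : 3 * k ≤ n → ⊥
        k-small 3k≤n = <⇒≱ 0<kn (≤-trans (m≤m+n (k * n) _) (+-cancelˡ-≤ (4 * (n * y)) (2 * (k * n)) 0 (begin
          4 * (n * y) + 2 * (k * n)                 ≤⟨ +-monoˡ-≤ (2 * (k * n)) (m≤m+n (4 * (n * y)) (4 * (y * y))) ⟩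
          4 * (n * y) + 4 * (y * y) + 2 * (k * n)   ≤⟨ main ⟩
          12 * (k * y)                              ≡⟨ l₁ k y ⟩
          4 * (3 * k * y)                           ≤⟨ *-monoʳ-≤ 4 (*-monoˡ-≤ y 3k≤n) ⟩
          4 * (n * y)                               ≡⟨ +-identityʳ _ ⟨
          4 * (n * y) + 0 ∎)))
          where
          l₁ : ∀ k y → 12 * (k * y) ≡ 4 * (3 * k * y)
          l₁ = solve-∀

        -- From r ≥ 2: k is at most (n + e)/2, and e ≤ n/16 keeps it within n/24 of n/2.
        24k≤13n : 24 * k ≤ 13 * n
        24k≤13n = begin
          24 * k                ≡⟨ l₁ k ⟩
          12 * (2 * k)          ≤⟨ *-monoʳ-≤ 12 (*-monoˡ-≤ k 2≤r) ⟩
          12 * (r * k)          ≡⟨ cong (12 *_) rk≡ ⟩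
          12 * (n + e)          ≡⟨ *-distribˡ-+ 12 n e ⟩
          12 * n + 12 * e       ≤⟨ +-monoʳ-≤ (12 * n) (≤-trans (*-monoˡ-≤ e (m≤m+n 12 4)) 16e≤n) ⟩
          12 * n + n            ≡⟨ +-comm (12 * n) n ⟩
          13 * n ∎
          where
          l₁ : ∀ k → 24 * k ≡ 12 * (2 * k)
          l₁ = solve-∀

        -- (2y − n)² ≥ 0 rules this case out.
        k-large : n < 3 * k → ⊥
        k-large n<3k = <-irrefl refl (begin-strict
          24 * (y * y) + 4 * (n * n) + 24 * (n * y)     ≡⟨ l₁ y n ⟩
          24 * (y * y) + 24 * (n * y) + 4 * n * n       <⟨ +-monoʳ-< (24 * (y * y) + 24 * (n * y)) (*-monoʳ-< (4 * n) {{>-nonZero (≤-trans 0<n (m≤m+n n _))}} n<3k) ⟩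
          24 * (y * y) + 24 * (n * y) + 4 * n * (3 * k) ≡⟨ l₂ y n k ⟩
          6 * (4 * (n * y) + 4 * (y * y) + 2 * (k * n)) ≤⟨ *-monoʳ-≤ 6 main ⟩
          6 * (12 * (k * y))                            ≡⟨ l₃ k y ⟩
          3 * (24 * k * y)                              ≤⟨ *-monoʳ-≤ 3 (*-monoˡ-≤ y 24k≤13n) ⟩
          3 * (13 * n * y)                              ≡⟨ l₄ n y ⟩
          15 * (n * y) + 24 * (n * y)                   ≤⟨ +-monoˡ-≤ (24 * (n * y)) (*-monoˡ-≤ (n * y) (m≤m+n 15 1)) ⟩
          16 * (n * y) + 24 * (n * y)                   ≡⟨ cong (_+ 24 * (n * y)) (l₅ n y) ⟩
          4 * (2 * (2 * y * n)) + 24 * (n * y)          ≤⟨ +-monoˡ-≤ (24 * (n * y)) (*-monoʳ-≤ 4 (2xy≤x²+y² (2 * y) n)) ⟩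
          4 * (2 * y * (2 * y) + n * n) + 24 * (n * y)  ≡⟨ cong (_+ 24 * (n * y)) (l₆ n y) ⟩
          16 * (y * y) + 4 * (n * n) + 24 * (n * y)     ≤⟨ +-monoˡ-≤ (24 * (n * y)) (+-monoˡ-≤ (4 * (n * n)) (*-monoˡ-≤ (y * y) (m≤m+n 16 8))) ⟩
          24 * (y * y) + 4 * (n * n) + 24 * (n * y) ∎)
          where
          l₁ : ∀ y n → 24 * (y * y) + 4 * (n * n) + 24 * (n * y) ≡ 24 * (y * y) + 24 * (n * y) + 4 * n * n
          l₁ = solve-∀
          l₂ : ∀ y n k → 24 * (y * y) + 24 * (n * y) + 4 * n * (3 * k) ≡ 6 * (4 * (n * y) + 4 * (y * y) + 2 * (k * n))
          l₂ = solve-∀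
          l₃ : ∀ k y → 6 * (12 * (k * y)) ≡ 3 * (24 * k * y)
          l₃ = solve-∀
          l₄ : ∀ n y → 3 * (13 * n * y) ≡ 15 * (n * y) + 24 * (n * y)
          l₄ = solve-∀
          l₅ : ∀ n y → 16 * (n * y) ≡ 4 * (2 * (2 * y * n))
          l₅ = solve-∀
          l₆ : ∀ n y → 4 * (2 * y * (2 * y) + n * n) ≡ 16 * (y * y) + 4 * (n * n)
          l₆ = solve-∀

    counting-contradiction : ⊥
    counting-contradiction with ≤-total (2 * m) n
    ... | inj₁ 2m≤n = let y , eq = m≤n⇒∃[o]m+o≡n 2m≤n in below y eq
    ... | inj₂ n≤2m = let y , eq = m≤n⇒∃[o]m+o≡n n≤2m in above y eq

  -- A Hamilton cycle with k edges of one colour, and the choice of k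

  degree-∑ : ∀ {n} (G : Graph n) v → Graph.degree G v ≡ ∑[ u ∈ allFin n ] χ (Graph.adj G v u)
  degree-∑ {n} G v = length-filter-χ (λ u → T? (Graph.adj G v u)) (allFin n)

  minDegree≤degree : ∀ {n} (G : Graph n) v → Graph.minDegree G ≤ Graph.degree G v
  minDegree≤degree {n} G v = All.lookup (min≤xs n (map (Graph.degree G) (allFin n))) (∈-map⁺ (Graph.degree G) (∈-allFin v))

  -- Every colour is tried. The first forest with k edges yields the cycle; if there is none, the
  -- sets of all colours are at hand for the double count.
  monochromatic : ∀ {r n k} → 2 ≤ r → 96 * (r * r) ≤ n → n ≤ r * k → 14 * (r * (r * k)) ≤ 14 * (r * n) + n + 14 * (r * r) →
                  (G : Graph n) → n + k ≤ 2 * Graph.minDegree G → (c : Colouring G r) →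
                  Σ[ H ∈ HamiltonCycle G ] Σ[ i ∈ Fin r ] k ≤ HamiltonCycle.edgesOfColour H c i
  monochromatic {r} {n} {k} 2≤r n-large n≤rk k-small G δ-large c = conclude (∀-⊎ (allFin r) λ i _ → attempt i)
    where
    open Graph G
    #n : length (allFin n) ≡ n
    #n = length-tabulate id
    #r : length (allFin r) ≡ r
    #r = length-tabulate id

    degree-bound : ∀ v → length (allFin n) + k ≤ 2 * (∑[ u ∈ allFin n ] χ (adj v u))
    degree-bound v = begin
      length (allFin n) + k                    ≡⟨ cong (_+ k) #n ⟩
      n + k                                    ≤⟨ δ-large ⟩
      2 * minDegree                            ≤⟨ *-monoʳ-≤ 2 (minDegree≤degree G v) ⟩
      2 * degree v                             ≡⟨ cong (2 *_) (degree-∑ G v) ⟩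
      2 * (∑[ u ∈ allFin n ] χ (adj v u)) ∎
      where open ≤-Reasoning

    Goal : Set
    Goal = Σ[ H ∈ HamiltonCycle G ] Σ[ i ∈ Fin r ] k ≤ HamiltonCycle.edgesOfColour H c i

    3≤n : 3 ≤ n
    3≤n = ≤-trans (*-mono-≤ {3} {96} (s≤s (s≤s (s≤s z≤n))) (*-mono-≤ {1} {r} {1} {r} (<⇒≤ 2≤r) (<⇒≤ 2≤r))) n-large

    irr : ∀ i {v} → ¬ T (coloured G c i v v)
    irr i vv = adj-irr (coloured⇒~ G c i vv)

    Sparseᵢ : Fin r → Set
    Sparseᵢ i = LinearForest.Sparse (coloured G c i) (coloured-sym G c i) (irr i) (allFin n) k

    attempt : ∀ i → Goal ⊎ Sparseᵢ i
    attempt i = [ (λ forest → inj₁ (let H , k≤ = hamiltonCycle G c i k degree-bound 3≤n forest in H , i , k≤)) , inj₂ ]′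
                  (LinearForest.forest-or-sparse (coloured G c i) (coloured-sym G c i) (irr i) (allFin n) k)

    conclude : Goal ⊎ (∀ i → i ∈ allFin r → Sparseᵢ i) → Goal
    conclude (inj₁ goal)   = goal
    conclude (inj₂ sparse) = ⊥-elim (counting-contradiction 2≤r (sym n+e≡rk) e-small n-large
      (subst (_≤ m + σ) #n n≤m+σ) (subst (λ r → 2 * σ ≤ r * k) #r 2σ≤rk)
      (subst₂ (λ n r → m * (k + 2 * m) + 4 * k * σ ≤ 2 * (r * (k * k + 6 * n)) + m * n) #n #r edge-count))
      where
      e = proj₁ (m≤n⇒∃[o]m+o≡n n≤rk)
      n+e≡rk = proj₂ (m≤n⇒∃[o]m+o≡n n≤rk)

      e-small : 14 * (r * e) ≤ n + 14 * (r * r)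
      e-small = +-cancelˡ-≤ (14 * (r * n)) _ _ (begin
        14 * (r * n) + 14 * (r * e)          ≡⟨ l r n e ⟩
        14 * (r * (n + e))                   ≡⟨ cong (λ x → 14 * (r * x)) n+e≡rk ⟩
        14 * (r * (r * k))                   ≤⟨ k-small ⟩
        14 * (r * n) + n + 14 * (r * r)      ≡⟨ +-assoc (14 * (r * n)) n _ ⟩
        14 * (r * n) + (n + 14 * (r * r)) ∎)
        where
        open ≤-Reasoning
        l : ∀ r n e → 14 * (r * n) + 14 * (r * e) ≡ 14 * (r * (n + e))
        l = solve-∀

      S : Fin r → Fin n → Bool
      S i = proj₁ (sparse i (∈-allFin i))

      coloured-by : ∀ {u v} → T (adj u v) → ∃[ i ] i ∈ allFin r × T (coloured G c i u v)
      coloured-by {u} {v} uv = c (⟦_⟧ G {u} {v} uv) , ∈-allFin _ , edge-coloured G c {u} {v} uv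

      small : ∀ i → 2 * (∑[ v ∈ allFin n ] χ (S i v)) ≤ k
      small i = proj₁ (proj₂ (sparse i (∈-allFin i)))

      few : ∀ i → (∑[ u ∈ allFin n ] ∑[ v ∈ allFin n ] χ (not (S i u)) * (χ (not (S i v)) * χ (coloured G c i u v)))
                    + 2 * k * (∑[ v ∈ allFin n ] χ (S i v)) ≤ k * k + 6 * length (allFin n)
      few i = proj₂ (proj₂ (sparse i (∈-allFin i)))

      open DoubleCount (allFin n) (allFin r) adj (coloured G c) coloured-by k S small few degree-bound

  -- The second argument of ⊓ keeps k close to n / r when the minimum degree is large.
  choose-k : ∀ {r n δ p q} → NonZero r → NonZero q →
             (r + 1) * n * q + p * (2 * r) ≤ δ * (2 * r * q) → p * (28 * r ^ 2) ≤ n * q →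
             ∃[ k ] n + k ≤ 2 * δ × n ≤ r * k × 14 * (r * (r * k)) ≤ 14 * (r * n) + n + 14 * (r * r) ×
               n * q + 2 * p * r ≤ k * (r * q)
  choose-k {r} {n} {δ} {p} {q} r≢0 q≢0 h₁ h₂ = k , n+k≤ , n≤rk , k-small , enough
    where
    open ≤-Reasoning
    instance
      _ = r≢0
      _ = q≢0
      rq≢0 : NonZero (r * q)
      rq≢0 = m*n≢0 r q
      14rr≢0 : NonZero (14 * (r * r))
      14rr≢0 = m*n≢0 14 (r * r) {{_}} {{m*n≢0 r r}}

    N = 14 * (r * n) + n
    -- The quotient before rounding is n/r + n/(14r²), the value of n/r + 2d for the largest
    -- admissible d. Rounding down and adding one exceeds it by at most one, which is the term 14r²
    -- in `k-small`.
    F = N / (14 * (r * r))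
    k = (2 * δ ∸ n) ⊓ suc F

    -- Ensures that the truncated difference `2 * δ ∸ n` is the true one.
    n≤2δ : n ≤ 2 * δ
    n≤2δ = *-cancelˡ-≤ (r * q) (begin
      r * q * n                             ≤⟨ ≤-trans (m≤m+n _ (n * q)) (m≤m+n _ (p * (2 * r))) ⟩
      r * q * n + n * q + p * (2 * r)       ≡⟨ l₁ r q n p ⟩
      (r + 1) * n * q + p * (2 * r)         ≤⟨ h₁ ⟩
      δ * (2 * r * q)                       ≡⟨ l₂ r q δ ⟩
      r * q * (2 * δ) ∎)
      where
      l₁ : ∀ r q n p → r * q * n + n * q + p * (2 * r) ≡ (r + 1) * n * q + p * (2 * r)
      l₁ = solve-∀
      l₂ : ∀ r q d → d * (2 * r * q) ≡ r * q * (2 * d)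
      l₂ = solve-∀

    n+k≤ : n + k ≤ 2 * δ
    n+k≤ = ≤-trans (+-monoʳ-≤ n (m⊓n≤m (2 * δ ∸ n) (suc F))) (≤-reflexive (m+[n∸m]≡n n≤2δ))

    k-small : 14 * (r * (r * k)) ≤ N + 14 * (r * r)
    k-small = begin
      14 * (r * (r * k))              ≡⟨ l r k ⟩
      k * (14 * (r * r))              ≤⟨ *-monoˡ-≤ (14 * (r * r)) (m⊓n≤n (2 * δ ∸ n) (suc F)) ⟩
      suc F * (14 * (r * r))          ≡⟨ +-comm (14 * (r * r)) _ ⟩
      F * (14 * (r * r)) + 14 * (r * r) ≤⟨ +-monoˡ-≤ (14 * (r * r)) (m/n*n≤m N (14 * (r * r))) ⟩
      N + 14 * (r * r) ∎
      where
      l : ∀ r k → 14 * (r * (r * k)) ≡ k * (14 * (r * r))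
      l = solve-∀

    enough₁ : ∀ {j} → n + j ≡ 2 * δ → n * q + 2 * p * r ≤ j * (r * q)
    enough₁ {j} eq = +-cancelˡ-≤ (r * n * q) _ _ (begin
      r * n * q + (n * q + 2 * p * r)   ≡⟨ l₁ r q n p ⟩
      (r + 1) * n * q + p * (2 * r)     ≤⟨ h₁ ⟩
      δ * (2 * r * q)                   ≡⟨ l₂ r q δ ⟩
      2 * δ * (r * q)                   ≡⟨ cong (_* (r * q)) eq ⟨
      (n + j) * (r * q)                 ≡⟨ l₃ r q n j ⟩
      r * n * q + j * (r * q) ∎)
      where
      l₁ : ∀ r q n p → r * n * q + (n * q + 2 * p * r) ≡ (r + 1) * n * q + p * (2 * r)
      l₁ = solve-∀
      l₂ : ∀ r q d → d * (2 * r * q) ≡ 2 * d * (r * q)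
      l₂ = solve-∀
      l₃ : ∀ r q n j → (n + j) * (r * q) ≡ r * n * q + j * (r * q)
      l₃ = solve-∀

    enough₂ : n * q + 2 * p * r ≤ suc F * (r * q)
    enough₂ = *-cancelˡ-≤ (14 * r) {{m*n≢0 14 r}} (begin
      14 * r * (n * q + 2 * p * r)             ≡⟨ l₁ r n q p ⟩
      -- `r * (r * 1)` is `r ^ 2` unfolded, the form in which `h₂` applies.
      14 * (r * n) * q + p * (28 * (r * (r * 1)))    ≤⟨ +-monoʳ-≤ (14 * (r * n) * q) h₂ ⟩
      14 * (r * n) * q + n * q                 ≡⟨ *-distribʳ-+ q (14 * (r * n)) n ⟨
      N * q                                    ≤⟨ *-monoˡ-≤ q N≤ ⟩
      suc F * (14 * (r * r)) * q               ≡⟨ l₂ r q (suc F) ⟩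
      14 * r * (suc F * (r * q)) ∎)
      where
      l₁ : ∀ r n q p → 14 * r * (n * q + 2 * p * r) ≡ 14 * (r * n) * q + p * (28 * (r * (r * 1)))
      l₁ = solve-∀
      l₂ : ∀ r q f → f * (14 * (r * r)) * q ≡ 14 * r * (f * (r * q))
      l₂ = solve-∀
      N≤ : N ≤ suc F * (14 * (r * r))
      N≤ = ≤-trans (≤-reflexive (m≡m%n+[m/n]*n N (14 * (r * r)))) (+-monoˡ-≤ (F * (14 * (r * r))) (<⇒≤ (m%n<n N (14 * (r * r)))))

    enough : n * q + 2 * p * r ≤ k * (r * q)
    enough with ⊓-sel (2 * δ ∸ n) (suc F)
    ... | inj₁ k≡ = ≤-trans (enough₁ (m+[n∸m]≡n n≤2δ)) (≤-reflexive (cong (_* (r * q)) (sym k≡)))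
    ... | inj₂ k≡ = ≤-trans enough₂ (≤-reflexive (cong (_* (r * q)) (sym k≡)))

    n≤rk : n ≤ r * k
    n≤rk = *-cancelˡ-≤ q (begin
      q * n                     ≡⟨ *-comm q n ⟩
      n * q                     ≤⟨ m≤m+n _ (2 * p * r) ⟩
      n * q + 2 * p * r         ≤⟨ enough ⟩
      k * (r * q)               ≡⟨ l k r q ⟩
      q * (r * k) ∎)
      where
      l : ∀ k r q → k * (r * q) ≡ q * (r * k)
      l = solve-∀

-- Rational inequalities with cleared denominators

module _ where

  open import Data.Integer using (+_)
  open import Data.Nat using (_+_; _*_; _≤_)

  -- `_/_` cancels common factors. Among unnormalised rationals the denominator `b` is kept, and an
  -- inequality is by definition a comparison of cross products.
  /-toℚᵘ : ∀ a b .{{_ : NonZero b}} → toℚᵘ (+ a ℚ./ b) ℚᵘ.≃ + a ℚᵘ./ b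
  /-toℚᵘ a (suc b) = ℚ.toℚᵘ-fromℚᵘ (mkℚᵘ (+ a) b)

  pos-*+* : ∀ a b c d → + a ℤ.* + b ℤ.+ + c ℤ.* + d ≡ + (a * b + c * d)
  pos-*+* a b c d = cong₂ ℤ._+_ (sym (ℤ.pos-* a b)) (sym (ℤ.pos-* c d))

  ≤/⇒*≤ : ∀ p q-1 .(co : Coprime p (suc q-1)) a b .{{_ : NonZero b}} → mkℚ (+ p) q-1 co ℚ.≤ + a ℚ./ b → p * b ≤ a * suc q-1
  ≤/⇒*≤ p q co a b@(suc b-1) d≤ with ℚᵘ.≤-respʳ-≃ (/-toℚᵘ a b) (ℚ.toℚᵘ-mono-≤ d≤)
  ... | *≤* h = ℤ.drop‿+≤+ (subst₂ ℤ._≤_ (sym (ℤ.pos-* p b)) (sym (ℤ.pos-* a (suc q))) h)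

  /+≤⇒*+*≤ : ∀ a b .{{_ : NonZero b}} p q-1 .(co : Coprime p (suc q-1)) δ → + a ℚ./ b ℚ.+ mkℚ (+ p) q-1 co ℚ.≤ + δ ℚ./ 1 →
             a * suc q-1 + p * b ≤ δ * (b * suc q-1)
  /+≤⇒*+*≤ a b@(suc b-1) p q co δ h
    with ℚᵘ.≤-respʳ-≃ (/-toℚᵘ δ 1) (ℚᵘ.≤-respˡ-≃ (ℚᵘ.≃-trans (ℚ.toℚᵘ-homo-+ (+ a ℚ./ b) (mkℚ (+ p) q co)) (ℚᵘ.+-congˡ (mkℚᵘ (+ p) q) (/-toℚᵘ a b))) (ℚ.toℚᵘ-mono-≤ h))
  ... | *≤* h′ = ℤ.drop‿+≤+ (subst₂ ℤ._≤_ (trans (ℤ.*-identityʳ _) (pos-*+* a (suc q) p b)) (sym (ℤ.pos-* δ (b * suc q))) h′)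

  *+*≤⇒/+≤ : ∀ a b .{{_ : NonZero b}} p q-1 .(co : Coprime p (suc q-1)) k → a * suc q-1 + 2 * p * b ≤ k * (b * suc q-1) →
             + a ℚ./ b ℚ.+ (+ 2 ℚ./ 1) ℚ.* mkℚ (+ p) q-1 co ℚ.≤ + k ℚ./ 1
  *+*≤⇒/+≤ a b@(suc b-1) p q co k h = ℚ.toℚᵘ-cancel-≤
    (ℚᵘ.≤-respʳ-≃ (ℚᵘ.≃-sym (/-toℚᵘ k 1)) (ℚᵘ.≤-respˡ-≃ (ℚᵘ.≃-sym lhs) (*≤* cleared)))
    where
    lhs : toℚᵘ (+ a ℚ./ b ℚ.+ (+ 2 ℚ./ 1) ℚ.* mkℚ (+ p) q co) ℚᵘ.≃ mkℚᵘ (+ a) b-1 ℚᵘ.+ mkℚᵘ (+ 2) 0 ℚᵘ.* mkℚᵘ (+ p) q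
    lhs = ℚᵘ.≃-trans (ℚ.toℚᵘ-homo-+ (+ a ℚ./ b) ((+ 2 ℚ./ 1) ℚ.* mkℚ (+ p) q co))
      (ℚᵘ.+-cong (/-toℚᵘ a b) (ℚᵘ.≃-trans (ℚ.toℚᵘ-homo-* (+ 2 ℚ./ 1) (mkℚ (+ p) q co)) (ℚᵘ.*-congʳ {mkℚᵘ (+ p) q} (/-toℚᵘ 2 1))))

    cleared : (+ a ℤ.* + (1 * suc q) ℤ.+ (+ 2 ℤ.* + p) ℤ.* + b) ℤ.* + 1 ℤ.≤ + k ℤ.* + (b * (1 * suc q))
    cleared = subst₂ ℤ._≤_
      (sym (trans (ℤ.*-identityʳ _) (trans (cong (λ x → + a ℤ.* + (1 * suc q) ℤ.+ x ℤ.* + b) (sym (ℤ.pos-* 2 p)))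
        (trans (pos-*+* a (1 * suc q) (2 * p) b) (cong (λ x → + (a * x + 2 * p * b)) (*-identityˡ (suc q)))))))
      (trans (cong (λ x → + (k * (b * x))) (sym (*-identityˡ (suc q)))) (ℤ.pos-* k (b * (1 * suc q))))
      (+≤+ h)

open import Data.Integer using (+_)
open import Data.Rational using (_/_; _+_; _*_; _≤_)

theorem1p11 : ∀ (r : ℕ) .{{_ : NonZero r}} → 2 ℕ.≤ r →
    ∃[ n₀ ] ∀ (n : ℕ) → n₀ ℕ.≤ n →
    ∀ (d : ℚ) → 0ℚ ≤ d → d ≤ (+ n / (28 ℕ.* r ^ 2)) {{28r²≢0 r}} →
    ∀ (G : Graph n) →
    (+ ((r ℕ.+ 1) ℕ.* n) / (2 ℕ.* r)) {{2r≢0 r}} + d ≤ + Graph.minDegree G / 1 →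
    ∀ (c : Colouring G r) →
    Σ[ H ∈ HamiltonCycle G ] Σ[ k ∈ Fin r ]
    + n / r + (+ 2 / 1) * d ≤ + HamiltonCycle.edgesOfColour H c k / 1
-- With n ≥ 96r² and rk ≥ n one has k ≥ 96r, so that 24rn, the error stemming from the sources of
-- walks, is at most kn/4.
theorem1p11 r 2≤r = 96 ℕ.* (r ℕ.* r) , λ where
  -- As 0 ≤ d, the numerator of d is a natural number, and everything can be cleared to ℕ.
  n n-large (mkℚ -[1+ _ ] _ _) (ℚ.*≤* ())
  n n-large (mkℚ (+ p) q co) 0≤d d≤ G δ-large c →
    let k , n+k≤ , n≤rk , k-small , enough = choose-k {r} {n} {Graph.minDegree G} {p} {suc q} (>-nonZero (<⇒≤ 2≤r)) _
          (/+≤⇒*+*≤ ((r ℕ.+ 1) ℕ.* n) (2 ℕ.* r) {{2r≢0 r}} p q co (Graph.minDegree G) δ-large)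
          (≤/⇒*≤ p q co n (28 ℕ.* r ^ 2) {{28r²≢0 r}} d≤)
        H , i , k≤ = monochromatic 2≤r n-large n≤rk k-small G n+k≤ c
    in H , i , *+*≤⇒/+≤ n r p q co (HamiltonCycle.edgesOfColour H c i)
                 (≤-trans enough (*-monoˡ-≤ (r ℕ.* suc q) k≤))
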